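{- Let $\mathbb P$ be a separative partial order with a largest element, $\mathbb B$ its Boolean algebra, $U$ an ultrafilter on $\mathbb B$ such that $\check{\mathrm V}_U$ is well-founded, and $G=[\dot G]_U$. If $G$ is uniformly represented with respect to $U$, then the following are equivalent (where $A$ ranges over the maximal antichains of $\mathbb P$): \begin{enumerate} \item $\bigcap_{A\subseteq\mathbb P}M_A=\mathrm V^{\mathbb B}/U$. \item Every $x\in\bigcap_{A\subseteq\mathbb P}M_A$ with $x\subseteq\check{\mathrm V}_U$ is CEU with respect to $U$. \end{enumerate}
   Context: $\mathbb B$ is the complete Boolean algebra of $\mathbb P$, with $\mathbb P$ viewed as a dense subset of $\mathbb B\setminus\{0\}$; $U\in\mathrm V$. $\mathrm V^{\mathbb B}/U$ consists of the classes $[\sigma]_U$ of $\mathbb B$-names under $\sigma\sim\tau$ iff $[\![\sigma=\tau]\!]\in U$, with $[\sigma]_U\,E\,[\tau]_U$ iff $[\![\sigma\in\tau]\!]\in U$. The Boolean ultrapower $\check{\mathrm V}_U\subseteq\mathrm V^{\mathbb B}/U$ consists of the classes of names with $[\![\sigma\in\check{\mathrm V}]\!]=\bigvee_{x\in\mathrm V}[\![\sigma=\check x]\!]\in U$, and $j:\mathrm V\to\check{\mathrm V}_U$, $j(x)=[\check x]_U$. $\dot G$ is the canonical name for the generic filter and $G=[\dot G]_U$, which is $j(\mathbb B)$-generic over $\check{\mathrm V}_U$, with $\check{\mathrm V}_U[G]=\mathrm V^{\mathbb B}/U$. All models are taken to be transitive. For a maximal antichain $A\subseteq\mathbb P$,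 $U_A=\{X\subseteq A\mid\bigvee X\in U\}$, $M_A$ is the transitive ultrapower of $\mathrm V$ by $U_A$, $b_A$ is the unique element of $j(A)\cap G$, and $\pi_{A,\infty}:M_A\to\check{\mathrm V}_U$ is $\pi_{A,\infty}([f]_{U_A})=j(f)(b_A)$. For $x\subseteq\check{\mathrm V}_U$, $x_A=\pi_{A,\infty}^{ -1}[x]$. $B\le^*A$ means every element of $B$ is below some element of $A$. A set $x\subseteq\check{\mathrm V}_U$ is uniformly represented with respect to $U$ if there is a function $\vec x=\langle x_p\mid p\in\mathbb P\rangle$ in $\mathrm V$ with $x_A=[\vec x\restriction A]_{U_A}$ for every maximal antichain $A\subseteq\mathbb P$. For a maximal antichain $A\subseteq\mathbb P$, let $\mathbb P_{\le A}=\{p\mid\exists q\in A\ p\le q\}$; $\vec x=\langle x_p\mid p\in\mathbb P_{\le A}\rangle$ is a uniform representation of $x$ below $A$ if $[\vec x\restriction B]_{U_B}=x_B$ for every maximal antichain $B\le^*A$ of $\mathbb P$. It is an eventually uniform representation of $x$ if it is a uniform representation of $x$ below some maximal antichain. Such a representation is continuous if for every $y$ and every $p\in\mathbb P$ there is $q\le p$ (with $q$ in $\mathbb P_{\le A}$) such that for all $r_1,r_2\le q$: $y\in x_{r_1}$ iff $y\in x_{r_2}$. A set $x\subseteq\check{\mathrm V}_U$ is CEU (with respect to $U$) if it has a continuous, eventually uniform representation. -}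

module Defs where

open import Level using (Level; _⊔_; suc; Lift; lift)
open import Data.Bool.Base using (Bool; true; false)
open import Data.Product using (Σ-syntax; ∃; ∃-syntax; _×_; _,_; proj₁; proj₂)
open import Data.Sum.Base using (_⊎_)
open import Function.Base using (_∘_; _on_)
open import Function.Bundles using (Func; Injection; Surjection; _⇔_; _⟶ₛ_; _⟨$⟩_)
open import Relation.Binary.Bundles using (Poset; Setoid)
open import Relation.Binary.Core using (Rel)
open import Relation.Binary.Lattice.Bundles using (BooleanAlgebra)
open import Relation.Binary.Morphism.Structures using (IsOrderMonomorphism)
import Relation.Binary.Construct.On as On
open import Relation.Nullary.Negation.Core using (¬_)
open import Relation.Unary using (Pred)
import Relation.Unary as Unary

-- The mathematics is classical ZFC.  Excluded middle is taken from the
-- library; choice is "every surjection of setoids splits", the section being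
-- required to respect the equalities (without that clause the statement is
-- provable in type theory and is not the axiom of choice).

AxiomOfChoice : (ℓ : Level) → Set (suc ℓ)
AxiomOfChoice ℓ = {S T : Setoid ℓ ℓ} (f : Surjection S T) →
  Σ[ g ∈ Func T S ] (∀ y → Setoid._≈_ T (Surjection.to f (Func.to g y)) y)

------------------------------------------------------------------------
-- The universe V: Aczel's iterative sets.  "Sets" are the elements of 𝕍 ℓ (or
-- structures on types in Set ℓ); classes are predicates on 𝕍 ℓ.

data 𝕍 (ℓ : Level) : Set (suc ℓ) where
  sup : (I : Set ℓ) → (I → 𝕍 ℓ) → 𝕍 ℓ

module _ {ℓ : Level} where

  infix 4 _≐_ _∈_

  _≐_ : 𝕍 ℓ → 𝕍 ℓ → Set ℓ
  sup I f ≐ sup J g = (∀ i → ∃[ j ] f i ≐ g j) × (∀ j → ∃[ i ] f i ≐ g j)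

  _∈_ : 𝕍 ℓ → 𝕍 ℓ → Set ℓ
  x ∈ sup I f = ∃[ i ] x ≐ f i

  ≐-refl : ∀ x → x ≐ x
  ≐-refl (sup I f) = (λ i → i , ≐-refl (f i)) , (λ i → i , ≐-refl (f i))

  ≐-sym : ∀ x y → x ≐ y → y ≐ x
  ≐-sym (sup I f) (sup J g) (p , q) =
    (λ j → let (i , e) = q j in i , ≐-sym (f i) (g j) e) ,
    (λ i → let (j , e) = p i in j , ≐-sym (f i) (g j) e)

  ≐-trans : ∀ x y z → x ≐ y → y ≐ z → x ≐ z
  ≐-trans (sup I f) (sup J g) (sup K h) (p , q) (r , s) =
    (λ i → let (j , e) = p i ; (k , e′) = r j in k , ≐-trans (f i) (g j) (h k) e e′) ,
    (λ k → let (j , e′) = s k ; (i , e) = q j in i , ≐-trans (f i) (g j) (h k) e e′)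

  𝕍-setoid : Setoid (suc ℓ) ℓ
  𝕍-setoid = record
    { Carrier       = 𝕍 ℓ
    ; _≈_           = _≐_
    ; isEquivalence = record
      { refl  = λ {x} → ≐-refl x
      ; sym   = λ {x} {y} → ≐-sym x y
      ; trans = λ {x} {y} {z} → ≐-trans x y z
      }
    }

  ｛_,_｝ : 𝕍 ℓ → 𝕍 ℓ → 𝕍 ℓ
  ｛ x , y ｝ = sup (Lift ℓ Bool) λ { (lift true) → x ; (lift false) → y }

  -- Kuratowski pair
  ⟪_,_⟫ : 𝕍 ℓ → 𝕍 ℓ → 𝕍 ℓ
  ⟪ x , y ⟫ = ｛ ｛ x , x ｝ , ｛ x , y ｝ ｝

  -- Collapse E c x says that x is the value at c of the Mostowski collapse of
  -- (C , E), i.e. x = { collapse of d ∣ d E c }.  Equivalent points of C have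
  -- the same collapse, so C may consist of representatives of the points of
  -- the structure being collapsed.
  Collapse : ∀ {c r} {C : Set c} → Rel C r → C → 𝕍 ℓ → Set (c ⊔ r ⊔ ℓ)
  Collapse E c (sup I f) =
    (∀ d → E d c → ∃[ i ] Collapse E d (f i)) ×
    (∀ i → ∃[ d ] E d c × Collapse E d (f i))

------------------------------------------------------------------------
-- Complete Boolean algebras, ultrafilters, completions of partial orders

record CompleteBooleanAlgebra (ℓ : Level) : Set (suc ℓ) where
  field
    booleanAlgebra : BooleanAlgebra ℓ ℓ ℓ

  open BooleanAlgebra booleanAlgebra public renaming (¬_ to ∁_; ⊤ to 𝟏; ⊥ to 𝟎)

  IsLub : ∀ {i} {I : Set i} → (I → Carrier) → Carrier → Set (i ⊔ ℓ)
  IsLub f b = (∀ i → f i ≤ b) × (∀ u → (∀ i → f i ≤ u) → b ≤ u)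

  IsGlb : ∀ {i} {I : Set i} → (I → Carrier) → Carrier → Set (i ⊔ ℓ)
  IsGlb f b = (∀ i → b ≤ f i) × (∀ u → (∀ i → u ≤ f i) → u ≤ b)

  field
    ⋁     : {I : Set ℓ} → (I → Carrier) → Carrier
    ⋀     : {I : Set ℓ} → (I → Carrier) → Carrier
    ⋁-lub : {I : Set ℓ} (f : I → Carrier) → IsLub f (⋁ f)
    ⋀-glb : {I : Set ℓ} (f : I → Carrier) → IsGlb f (⋀ f)

record Ultrafilter {ℓ} (B : CompleteBooleanAlgebra ℓ) : Set (suc ℓ) where
  open CompleteBooleanAlgebra B
  field
    member : Pred Carrier ℓ
    upward : ∀ {a b} → a ≤ b → member a → member b
    meet   : ∀ {a b} → member a → member b → member (a ∧ b)
    top    : member 𝟏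
    proper : ¬ member 𝟎
    ultra  : ∀ a → member a ⊎ member (∁ a)

module _ {ℓ : Level} (P : Poset ℓ ℓ ℓ) where
  open Poset P

  _⊥_ : Rel Carrier ℓ
  p ⊥ q = ¬ (∃[ r ] r ≤ p × r ≤ q)

  Separative : Set ℓ
  Separative = ∀ p q → ¬ (p ≤ q) → ∃[ r ] r ≤ p × r ⊥ q

  record IsAntichain (A : Pred Carrier ℓ) : Set ℓ where
    field
      respects     : ∀ {p q} → p ≈ q → A p → A q
      incompatible : ∀ {p q} → A p → A q → ¬ (p ≈ q) → p ⊥ q

  record MaximalAntichain : Set (suc ℓ) where
    field
      elements    : Pred Carrier ℓ
      isAntichain : IsAntichain elements
      maximal     : ∀ (A : Pred Carrier ℓ) → IsAntichain A →
                    elements Unary.⊆ A → A Unary.⊆ elements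

  -- ι identifies P with a dense subset of B ∖ {0}.  Since B is a set in V, its
  -- elements are themselves sets: ⌜ b ⌝ is b as an element of V.
  record Completion : Set (suc ℓ) where
    field
      algebra : CompleteBooleanAlgebra ℓ

    private module B = CompleteBooleanAlgebra algebra

    field
      ι           : Carrier → B.Carrier
      ι-embedding : IsOrderMonomorphism _≈_ B._≈_ _≤_ B._≤_ ι
      ι-nonzero   : ∀ p → ¬ (ι p B.≈ B.𝟎)
      ι-dense     : ∀ b → ¬ (b B.≈ B.𝟎) → ∃[ p ] ι p B.≤ b
      code        : Injection B.setoid (𝕍-setoid {ℓ})

    ⌜_⌝ : B.Carrier → 𝕍 ℓ
    ⌜_⌝ = Injection.to code

------------------------------------------------------------------------
-- The Boolean ultrapower and the ultrapowers by maximal antichains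

module BooleanUltrapower {ℓ : Level} (P : Poset ℓ ℓ ℓ) (C : Completion P)
                         (U : Ultrafilter (Completion.algebra C)) where

  private
    module P = Poset P
    module U = Ultrafilter U
  open Completion C
  open CompleteBooleanAlgebra algebra
    renaming (Carrier to 𝔹; _≤_ to _≤ᴮ_; _≈_ to _≈ᴮ_)
  open MaximalAntichain using (elements)

  data Name : Set (suc ℓ) where
    name : (I : Set ℓ) → (I → Name) → (I → 𝔹) → Name

  ⟦_≐_⟧ : Name → Name → 𝔹
  ⟦ name I σ b ≐ name J τ c ⟧ =
    (⋀ λ i → b i ⇨ ⋁ λ j → c j ∧ ⟦ σ i ≐ τ j ⟧) ∧
    (⋀ λ j → c j ⇨ ⋁ λ i → b i ∧ ⟦ σ i ≐ τ j ⟧)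

  ⟦_∈_⟧ : Name → Name → 𝔹
  ⟦ σ ∈ name J τ c ⟧ = ⋁ λ j → c j ∧ ⟦ σ ≐ τ j ⟧

  check : 𝕍 ℓ → Name
  check (sup I f) = name I (check ∘ f) (λ _ → 𝟏)

  Ġ : Name
  Ġ = name 𝔹 (check ∘ ⌜_⌝) (λ b → b)

  _E_ : Rel Name ℓ
  σ E τ = U.member ⟦ σ ∈ τ ⟧

  -- ⟦ σ ∈ V̌ ⟧ ∈ U.  The supremum is indexed by a proper class, hence IsLub
  -- rather than ⋁.
  InV̌ : Pred Name (suc ℓ)
  InV̌ σ = ∃[ b ] IsLub (λ x → ⟦ σ ≐ check x ⟧) b × U.member b

  _Eᵛ_ : Rel (∃ InV̌) ℓ
  _Eᵛ_ = _E_ on proj₁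

  -- All models are transitive: [ σ ]≐ x says that x is the point [σ]_U of the
  -- transitive collapse of V^𝔹/U.  The Boolean ultrapower is a transitive
  -- subclass of V^𝔹/U, so it is collapsed by the same map.
  [_]≐_ : Name → 𝕍 ℓ → Set (suc ℓ)
  [ σ ]≐ x = Collapse _E_ σ x

  V^𝔹/U : Pred (𝕍 ℓ) (suc ℓ)
  V^𝔹/U x = ∃[ σ ] [ σ ]≐ x

  V̌ᵤ : Pred (𝕍 ℓ) (suc ℓ)
  V̌ᵤ x = ∃[ σ ] InV̌ σ × [ σ ]≐ x

  _⊆V̌ᵤ : Pred (𝕍 ℓ) (suc ℓ)
  x ⊆V̌ᵤ = ∀ y → y ∈ x → V̌ᵤ y

  j_≐_ : 𝕍 ℓ → 𝕍 ℓ → Set (suc ℓ)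
  j x ≐ y = [ check x ]≐ y

  -- A subset of P as a setoid in which the membership proofs are irrelevant.
  Sub : Pred P.Carrier ℓ → Setoid ℓ ℓ
  Sub X = On.setoid P.Eq.setoid (proj₁ {B = X})

  _→𝕍 : Pred P.Carrier ℓ → Set (suc ℓ)
  X →𝕍 = Sub X ⟶ₛ 𝕍-setoid {ℓ}

  restrict : ∀ {X Y : Pred P.Carrier ℓ} → X Unary.⊆ Y → Y →𝕍 → X →𝕍
  restrict X⊆Y f = record
    { to   = λ (p , p∈X) → f ⟨$⟩ (p , X⊆Y p∈X)
    ; cong = Func.cong f
    }

  _↾_ : P.Eq.setoid ⟶ₛ 𝕍-setoid {ℓ} → (X : Pred P.Carrier ℓ) → X →𝕍
  f ↾ X = record { to = λ (p , _) → f ⟨$⟩ p ; cong = Func.cong f }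

  P≤ : MaximalAntichain P → Pred P.Carrier ℓ
  P≤ A p = ∃[ q ] elements A q × p P.≤ q

  _≤*_ : Rel (MaximalAntichain P) ℓ
  B ≤* A = elements B Unary.⊆ P≤ A

  module _ (A : MaximalAntichain P) where

    private ∣A∣ = ∃ (elements A)

    Uₐ : Pred (Pred ∣A∣ ℓ) ℓ
    Uₐ X = U.member (⋁ {I = ∃ X} λ ((a , _) , _) → ι a)

    _Eₐ_ : Rel (elements A →𝕍) ℓ
    f Eₐ g = Uₐ λ a → (f ⟨$⟩ a) ∈ (g ⟨$⟩ a)

    -- m is the point [f] of the transitive ultrapower by Uₐ
    [_]ₐ≐_ : elements A →𝕍 → 𝕍 ℓ → Set (suc ℓ)
    [ f ]ₐ≐ m = Collapse _Eₐ_ f m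

    M : Pred (𝕍 ℓ) (suc ℓ)
    M m = ∃[ f ] [ f ]ₐ≐ m

    asSet : 𝕍 ℓ
    asSet = sup ∣A∣ λ (a , _) → ⌜ ι a ⌝

    graph : elements A →𝕍 → 𝕍 ℓ
    graph f = sup ∣A∣ λ a → ⟪ ⌜ ι (proj₁ a) ⌝ , f ⟨$⟩ a ⟫

    -- b is the unique element of j(A) ∩ G
    Isbₐ : Pred (𝕍 ℓ) (suc ℓ)
    Isbₐ b = ∃[ jA ] ∃[ G ] (j asSet ≐ jA) × ([ Ġ ]≐ G) × b ∈ jA × b ∈ G ×
      (∀ c → c ∈ jA → c ∈ G → c ≐ b)

    -- π_{A,∞}(m) ≐ z, where π_{A,∞}([f]) = j(f)(b_A)
    π_≐_ : 𝕍 ℓ → 𝕍 ℓ → Set (suc ℓ)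
    π m ≐ z = ∃[ f ] ([ f ]ₐ≐ m) ×
      (∃[ jf ] ∃[ b ] (j (graph f) ≐ jf) × Isbₐ b × ⟪ b , z ⟫ ∈ jf)

    -- m ∈ x_A, the preimage of x under π_{A,∞}
    _∈preimage_ : 𝕍 ℓ → 𝕍 ℓ → Set (suc ℓ)
    m ∈preimage x = ∃[ z ] (π m ≐ z) × z ∈ x

    -- [f] = x_A
    Represents : elements A →𝕍 → 𝕍 ℓ → Set (suc ℓ)
    Represents f x = ∃[ y ] ([ f ]ₐ≐ y) × (∀ m → m ∈ y ⇔ m ∈preimage x)

  UniformlyRepresented : Pred (𝕍 ℓ) (suc ℓ)
  UniformlyRepresented x = x ⊆V̌ᵤ ×
    (Σ[ x⃗ ∈ P.Eq.setoid ⟶ₛ 𝕍-setoid ] ∀ A → Represents A (x⃗ ↾ elements A) x)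

  RepresentsBelow : (A : MaximalAntichain P) → P≤ A →𝕍 → 𝕍 ℓ → Set (suc ℓ)
  RepresentsBelow A x⃗ x =
    ∀ B (B≤*A : B ≤* A) → Represents B (restrict B≤*A x⃗) x

  Continuous : (A : MaximalAntichain P) → P≤ A →𝕍 → Set (suc ℓ)
  Continuous A x⃗ = ∀ (y : 𝕍 ℓ) (p : P.Carrier) →
    ∃[ q ] q P.≤ p × P≤ A q ×
      (∀ (r₁ r₂ : ∃ (P≤ A)) → proj₁ r₁ P.≤ q → proj₁ r₂ P.≤ q →
        (y ∈ (x⃗ ⟨$⟩ r₁)) ⇔ (y ∈ (x⃗ ⟨$⟩ r₂)))

  CEU : Pred (𝕍 ℓ) (suc ℓ)
  CEU x = x ⊆V̌ᵤ ×
    (∃[ A ] Σ[ x⃗ ∈ P≤ A →𝕍 ] RepresentsBelow A x⃗ x × Continuous A x⃗)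

  ⋂M : Pred (𝕍 ℓ) (suc ℓ)
  ⋂M x = ∀ A → M A x

{-# OPTIONS --safe #-}
-- A uniform representation G⃗ of G lets each M_A compute V^𝔹/U: the value of σ is
-- the class of the function sending a to the collapse of σ by the relation
-- ⟦ d ∈ τ ⟧ ∈ G⃗ a.  Hence V^𝔹/U ⊆ ⋂M always holds, and (1) says ⋂M ⊆ V^𝔹/U.
--
-- (1) ⇒ (2): if x ⊆ V̌ᵤ is the value of σ, let x⃗ p consist of the y such that p
-- forces y̌ ∈ σ, or p does not decide this and ⟦ y̌ ∈ σ ⟧ ∈ G⃗ p.
--
-- (2) ⇒ (1): by ∈-induction the elements g i of x ∈ ⋂M are the values of names σ i.
-- Transporting x along the name of g i ↦ σ i gives x′ ⊆ j(x) in ⋂M with x′ ⊆ V̌ᵤ.  A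
-- continuous representation x⃗ of x′ yields the name { (y̌ , q) ∣ y ∈ x⃗ r for all
-- r ≤ q } of x′, and transporting back gives a name of x.
module Submission where

open import Defs
open import Axiom.ExcludedMiddle using (ExcludedMiddle)
open import Data.Bool.Base using (Bool; true; false)
open import Data.Empty using () renaming (⊥ to False)
open import Data.Empty.Polymorphic using () renaming (⊥ to Empty)
open import Data.Maybe.Base using (Maybe; just; nothing)
open import Data.Product using (Σ-syntax; ∃; ∃-syntax; _×_; _,_; proj₁; proj₂)
open import Data.Sum.Base using (_⊎_; inj₁; inj₂; [_,_]′)
open import Function.Base using (id; _∘_; _on_)
open import Function.Bundles using (Func; Injection; Surjection; Equivalence; _⇔_; mk⇔; _⟶ₛ_; _⟨$⟩_)
open import Induction.WellFounded using (Acc; acc; WellFounded)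
open import Level using (Level; _⊔_; suc; Lift; lift; lower)
open import Relation.Binary.Bundles using (Poset; Setoid)
import Relation.Binary.Construct.On as On
open import Relation.Binary.Core using (Rel)
open import Relation.Binary.Definitions using (Maximum; Symmetric)
open import Relation.Binary.Morphism.Structures using (IsOrderMonomorphism)
open import Relation.Binary.PropositionalEquality as ≡ using (_≡_; refl; sym; cong; subst)
open import Relation.Nullary using (¬_; contradiction; yes; no; does)
open import Relation.Nullary.Decidable using (True; toWitness; fromWitness; decidable-stable)
open import Relation.Unary using (Pred; _⊆_)

-- `M A` knows U only through `Uₐ A`, whereas membership between names depends on all of U. The
-- sequence `G⃗` supplies the missing information: whether a Boolean value lies in U can be read off
-- from `G⃗ a` for almost all a. A single `G⃗ a` is only a set, perhaps no filter, and the relation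
-- it defines on names need not be well-founded. So fibrewise facts are stated almost everywhere and
-- moved to names by arguments in the style of Łoś. In (2) ⇒ (1) uniformity alone yields no name,
-- since it compares classes along one antichain at a time. Continuity supplies, for each name μ of
-- a point of the Boolean ultrapower, an antichain along which both the set denoted by μ and its
-- membership in the representation are settled; uniformity is then applied to that antichain.
-- Hypothesis (2) can be applied to `x′` only if `x′` lies in every `M A`. Hence `G⃗` is used in
-- this direction too: each `M A` must evaluate the names in the range of the coding function.

module Classical (em : ∀ {a} → ExcludedMiddle a) where

  -- Excluded middle: resizing and Boolean reflection.

  by-contradiction : ∀ {a} {A : Set a} → ¬ ¬ A → A
  by-contradiction = decidable-stable em

  -- Excluded middle resizes a proposition of any level to any other level.
  ∥_∥ : ∀ {a ℓ} → Set a → Set ℓ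
  ∥_∥ {ℓ = ℓ} A = Lift ℓ (True (em {P = A}))

  ∣_∣ : ∀ {a ℓ} {A : Set a} → A → ∥_∥ {ℓ = ℓ} A
  ∣ x ∣ = lift (fromWitness x)

  unbox : ∀ {a ℓ} {A : Set a} → ∥_∥ {ℓ = ℓ} A → A
  unbox p = toWitness (lower p)

  ⌊_⌋ : ∀ {a} → Set a → Bool
  ⌊ A ⌋ = does (em {P = A})

  reflect : ∀ {a} {A : Set a} → A → ⌊ A ⌋ ≡ true
  reflect {A = A} x with em {P = A}
  ... | yes _ = refl
  ... | no ¬x = contradiction x ¬x

  reify : ∀ {a} {A : Set a} → ⌊ A ⌋ ≡ true → A
  reify {A = A} eq with em {P = A} | eq
  ... | yes x | _ = x
  ... | no _  | ()

  -- Choice functions and maximal cliques.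

  module _ {ℓ : Level} (ac : AxiomOfChoice ℓ) where

    module _ (S : Setoid ℓ ℓ) where
      open Setoid S

      private
        fromPropositional : Surjection (≡.setoid Carrier) S
        fromPropositional = record
          { to         = id
          ; cong       = reflexive
          ; surjective = λ y → y , reflexive
          }

      -- The identity from the discrete setoid is a surjection onto S. Its section respects
      -- equality, so equal points get the same representative, and any function composed with
      -- `canonical` is a setoid map.
      canonical : Carrier → Carrier
      canonical = Func.to (proj₁ (ac fromPropositional))

      canonical-≈ : ∀ x → canonical x ≈ x
      canonical-≈ = proj₂ (ac fromPropositional)

      canonical-≡ : ∀ {x y} → x ≈ y → canonical x ≡ canonical y
      canonical-≡ = Func.cong (proj₁ (ac fromPropositional))

    module _ {X : Set ℓ} where

      infix 4 _∈ᵇ_ _⊆ᵇ_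

      -- Boolean-valued, so that subsets form a type in `Set ℓ`: there `ac` applies to setoids of
      -- subsets, and families of subsets are no larger.
      Subset : Set ℓ
      Subset = X → Bool

      _∈ᵇ_ : X → Subset → Set
      x ∈ᵇ Q = Q x ≡ true

      _⊆ᵇ_ : Rel Subset ℓ
      Q ⊆ᵇ R = ∀ x → x ∈ᵇ Q → x ∈ᵇ R

      private
        -- The equality here keeps the marked point and that of `Inhabited` forgets it. A section is
        -- therefore a choice function on inhabited subsets that respects extensional equality.
        Pointed : Setoid ℓ ℓ
        Pointed = record
          { Carrier       = Σ[ Q ∈ Subset ] ∃ (_∈ᵇ Q)
          ; _≈_           = λ (Q , x , _) (R , y , _) → (∀ z → Q z ≡ R z) × x ≡ y
          ; isEquivalence = record
            { refl  = (λ _ → refl) , refl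
            ; sym   = λ (p , q) → (λ z → sym (p z)) , sym q
            ; trans = λ (p , q) (p′ , q′) → (λ z → ≡.trans (p z) (p′ z)) , ≡.trans q q′
            }
          }

        Inhabited : Setoid ℓ ℓ
        Inhabited = record
          { Carrier       = Σ[ Q ∈ Subset ] ∃ (_∈ᵇ Q)
          ; _≈_           = λ (Q , _) (R , _) → ∀ z → Q z ≡ R z
          ; isEquivalence = record
            { refl  = λ _ → refl
            ; sym   = λ p z → sym (p z)
            ; trans = λ p p′ z → ≡.trans (p z) (p′ z)
            }
          }

        forget : Surjection Pointed Inhabited
        forget = record
          { to         = id
          ; cong       = proj₁
          ; surjective = λ y → y , proj₁
          }

        section = ac forget

      choose : ∀ Q → ∃ (_∈ᵇ Q) → X
      choose Q ne = proj₁ (proj₂ (Func.to (proj₁ section) (Q , ne)))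

      choose-∈ : ∀ Q ne → choose Q ne ∈ᵇ Q
      choose-∈ Q ne = ≡.trans (sym (proj₂ section (Q , ne) (choose Q ne)))
                            (proj₂ (proj₂ (Func.to (proj₁ section) (Q , ne))))

      choose-cong : ∀ {Q R} ne ne′ → (∀ z → Q z ≡ R z) → choose Q ne ≡ choose R ne′
      choose-cong ne ne′ Q≗R = proj₂ (Func.cong (proj₁ section) Q≗R)

      -- Bourbaki–Witt: closing ∅ under unions and a map that adds at most one
      -- point yields a chain.
      module Tower (next : Subset → Subset)
                   (increasing : ∀ Q → Q ⊆ᵇ next Q)
                   (extensional : ∀ {Q R} → Q ⊆ᵇ R → R ⊆ᵇ Q → next Q ⊆ᵇ next R)
                   (tight : ∀ {Q R} → Q ⊆ᵇ R → R ⊆ᵇ next Q → R ⊆ᵇ Q ⊎ next Q ⊆ᵇ R)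
                   where

        ⋃ : (Subset → Bool) → Subset
        ⋃ F x = ⌊ (∃[ Q ] F Q ≡ true × x ∈ᵇ Q) ⌋

        data Tower : Subset → Set ℓ where
          step  : ∀ {Q} → Tower Q → Tower (next Q)
          union : ∀ F → (∀ Q → F Q ≡ true → Tower Q) → Tower (⋃ F)

        ⊆-trans : ∀ {Q R S} → Q ⊆ᵇ R → R ⊆ᵇ S → Q ⊆ᵇ S
        ⊆-trans p q x = q x ∘ p x

        ⋃-upper : ∀ F {Q} → F Q ≡ true → Q ⊆ᵇ ⋃ F
        ⋃-upper F FQ x x∈Q = reflect (_ , FQ , x∈Q)

        ⋃-least : ∀ F {R} → (∀ Q → F Q ≡ true → Q ⊆ᵇ R) → ⋃ F ⊆ᵇ R
        ⋃-least F below x x∈⋃ = let (Q , FQ , x∈Q) = reify x∈⋃ in below Q FQ x x∈Q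

        all-or-some : ∀ (F : Subset → Bool) R → (∀ Q → F Q ≡ true → Q ⊆ᵇ R) ⊎ (∃[ Q ] F Q ≡ true × ¬ (Q ⊆ᵇ R))
        all-or-some F R with em {P = ∃[ Q ] F Q ≡ true × ¬ (Q ⊆ᵇ R)}
        ... | yes some = inj₂ some
        ... | no ¬some = inj₁ λ Q FQ → by-contradiction λ Q⊈R → ¬some (Q , FQ , Q⊈R)

        -- Stronger than comparability, so that the induction passes successors. The outer induction
        -- is on Q; at a successor, `go` is an inner induction on R, and `tight` excludes an R
        -- strictly between Q and `next Q`.
        linear : ∀ {Q R} → Tower Q → Tower R → Q ⊆ᵇ R ⊎ next R ⊆ᵇ Q
        linear {R = R} (union F F⊆T) tR = go (all-or-some F R)
          where
          go : (∀ Q → F Q ≡ true → Q ⊆ᵇ R) ⊎ (∃[ Q ] F Q ≡ true × ¬ (Q ⊆ᵇ R)) →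
               ⋃ F ⊆ᵇ R ⊎ next R ⊆ᵇ ⋃ F
          go (inj₁ all) = inj₁ (⋃-least F all)
          go (inj₂ (Q , FQ , Q⊈R)) with linear (F⊆T Q FQ) tR
          ... | inj₁ Q⊆R = contradiction Q⊆R Q⊈R
          ... | inj₂ R⁺⊆Q = inj₂ (⊆-trans R⁺⊆Q (⋃-upper F FQ))
        linear {Q = Q⁺} (step {Q} tQ) = go
          where
          outer : ∀ {R} → Tower R → Q ⊆ᵇ R ⊎ next R ⊆ᵇ Q
          outer = linear tQ

          below : ∀ {R} → Tower R → R ⊆ᵇ Q → next Q ⊆ᵇ R ⊎ next R ⊆ᵇ next Q
          below tR R⊆Q with outer tR
          ... | inj₁ Q⊆R  = inj₂ (extensional R⊆Q Q⊆R)
          ... | inj₂ R⁺⊆Q = inj₂ (⊆-trans R⁺⊆Q (increasing Q))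

          go : ∀ {R} → Tower R → next Q ⊆ᵇ R ⊎ next R ⊆ᵇ next Q
          go (step {R} tR) with outer tR
          ... | inj₂ R⁺⊆Q = below (step tR) R⁺⊆Q
          ... | inj₁ Q⊆R with go tR
          ... | inj₁ Q⁺⊆R = inj₁ (⊆-trans Q⁺⊆R (increasing R))
          ... | inj₂ R⁺⊆Q⁺ with tight Q⊆R (⊆-trans (increasing R) R⁺⊆Q⁺)
          ... | inj₁ R⊆Q = inj₁ (extensional Q⊆R R⊆Q)
          ... | inj₂ Q⁺⊆R = inj₁ (⊆-trans Q⁺⊆R (increasing R))
          go (union F F⊆T) with all-or-some F Q
          ... | inj₁ all = below (union F F⊆T) (⋃-least F all)
          ... | inj₂ (R , FR , R⊈Q) with go (F⊆T R FR)
          ... | inj₁ Q⁺⊆R = inj₁ (⊆-trans Q⁺⊆R (⋃-upper F FR))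
          ... | inj₂ R⁺⊆Q⁺ with outer (F⊆T R FR)
          ... | inj₂ R⁺⊆Q = contradiction (⊆-trans (increasing R) R⁺⊆Q) R⊈Q
          ... | inj₁ Q⊆R with tight Q⊆R (⊆-trans (increasing R) R⁺⊆Q⁺)
          ... | inj₁ R⊆Q = contradiction R⊆Q R⊈Q
          ... | inj₂ Q⁺⊆R = inj₁ (⊆-trans Q⁺⊆R (⋃-upper F FR))

        comparable : ∀ {Q R} → Tower Q → Tower R → Q ⊆ᵇ R ⊎ R ⊆ᵇ Q
        comparable tQ tR with linear tQ tR
        ... | inj₁ Q⊆R  = inj₁ Q⊆R
        ... | inj₂ R⁺⊆Q = inj₂ (⊆-trans (increasing _) R⁺⊆Q)

        summit : Subset
        summit = ⋃ λ Q → ⌊ Tower Q ⌋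

        summit-tower : Tower summit
        summit-tower = union _ λ Q → reify

        -- The union of all stages is itself a stage, so its successor is one of the sets united.
        summit-fixed : next summit ⊆ᵇ summit
        summit-fixed = ⋃-upper _ (reflect (step summit-tower))

      module MaximalClique (R : Rel X ℓ) (R-sym : Symmetric R) where

        private
          candidates : Subset → Subset
          candidates Q x = ⌊ (¬ (x ∈ᵇ Q)) × (∀ y → y ∈ᵇ Q → R x y) ⌋

          next : Subset → Subset
          next Q x = ⌊ (x ∈ᵇ Q ⊎ (Σ[ ne ∈ ∃ (_∈ᵇ candidates Q) ] x ≡ choose (candidates Q) ne)) ⌋

          increasing : ∀ Q → Q ⊆ᵇ next Q
          increasing Q x = reflect ∘ inj₁

          ≡-true : ∀ {a b : Bool} → (a ≡ true → b ≡ true) → (b ≡ true → a ≡ true) → a ≡ b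
          ≡-true {true}  {true}  _ _ = refl
          ≡-true {false} {false} _ _ = refl
          ≡-true {true}  {false} p _ with () ← p refl
          ≡-true {false} {true}  _ q with () ← q refl

          candidates-⊆ : ∀ {Q R} → Q ⊆ᵇ R → R ⊆ᵇ Q → candidates Q ⊆ᵇ candidates R
          candidates-⊆ Q⊆R R⊆Q x x∈ = let (x∉Q , rel) = reify x∈ in
            reflect ((x∉Q ∘ R⊆Q x) , λ y → rel y ∘ R⊆Q y)

          extensional : ∀ {Q R} → Q ⊆ᵇ R → R ⊆ᵇ Q → next Q ⊆ᵇ next R
          extensional {Q} {R} Q⊆R R⊆Q x x∈ with reify x∈
          ... | inj₁ x∈Q = reflect (inj₁ (Q⊆R x x∈Q))
          ... | inj₂ (ne@(z , z∈) , refl) =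
            let ne′ = z , candidates-⊆ Q⊆R R⊆Q z z∈ in
            reflect (inj₂ (ne′ , choose-cong ne ne′ λ y →
              ≡-true (candidates-⊆ Q⊆R R⊆Q y) (candidates-⊆ R⊆Q Q⊆R y)))

          -- The chosen candidate does not depend on the proof that candidates exist, so `next Q`
          -- has at most one new point; an R with any new point contains that one.
          tight : ∀ {Q R} → Q ⊆ᵇ R → R ⊆ᵇ next Q → R ⊆ᵇ Q ⊎ next Q ⊆ᵇ R
          tight {Q} {R} Q⊆R R⊆Q⁺ with em {P = ∃[ x ] x ∈ᵇ R × ¬ (x ∈ᵇ Q)}
          ... | no none = inj₁ λ x x∈R → by-contradiction λ x∉Q → none (x , x∈R , x∉Q)
          ... | yes (x , x∈R , x∉Q) = inj₂ included
            where
            included : next Q ⊆ᵇ R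
            included y y∈ with reify y∈ | reify (R⊆Q⁺ x x∈R)
            ... | inj₁ y∈Q | _ = Q⊆R y y∈Q
            ... | inj₂ _ | inj₁ x∈Q = contradiction x∈Q x∉Q
            ... | inj₂ (ne , refl) | inj₂ (ne′ , refl) =
              subst (_∈ᵇ R) (choose-cong ne′ ne λ _ → refl) x∈R

        open Tower next increasing extensional tight

        private
          tower-clique : ∀ {Q} → Tower Q → ∀ x y → x ∈ᵇ Q → y ∈ᵇ Q → ¬ (x ≡ y) → R x y
          tower-clique (union F F⊆T) x y x∈ y∈ x≢y =
            let (Q , FQ , x∈Q) = reify x∈
                (S , FS , y∈S) = reify y∈
            in [ (λ Q⊆S → tower-clique (F⊆T S FS) x y (Q⊆S x x∈Q) y∈S x≢y)
               , (λ S⊆Q → tower-clique (F⊆T Q FQ) x y x∈Q (S⊆Q y y∈S) x≢y)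
               ]′ (comparable (F⊆T Q FQ) (F⊆T S FS))
          tower-clique (step {Q} tQ) x y x∈ y∈ x≢y with reify x∈ | reify y∈
          ... | inj₁ x∈Q | inj₁ y∈Q = tower-clique tQ x y x∈Q y∈Q x≢y
          ... | inj₁ x∈Q | inj₂ (ne , refl) =
            R-sym (proj₂ (reify (choose-∈ (candidates Q) ne)) x x∈Q)
          ... | inj₂ (ne , refl) | inj₁ y∈Q =
            proj₂ (reify (choose-∈ (candidates Q) ne)) y y∈Q
          ... | inj₂ (ne , refl) | inj₂ (ne′ , refl) =
            contradiction (choose-cong ne ne′ λ _ → refl) x≢y

        clique : Subset
        clique = summit

        clique-related : ∀ x y → x ∈ᵇ clique → y ∈ᵇ clique → ¬ (x ≡ y) → R x y
        clique-related = tower-clique summit-tower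

        -- A missing x would be a candidate, and the successor of `clique` would then contain a
        -- point outside `clique`, against `summit-fixed`.
        clique-maximal : ∀ x → (∀ y → y ∈ᵇ clique → R x y) → x ∈ᵇ clique
        clique-maximal x rel = by-contradiction λ x∉ →
          let ne = x , reflect (x∉ , rel)
              c∈ = choose-∈ (candidates clique) ne
          in proj₁ (reify c∈) (summit-fixed _ (reflect (inj₂ (ne , refl))))

-- Iterative sets and the Mostowski collapse.

SamePredecessors : ∀ {c r} {C : Set c} → Rel C r → Rel C (c ⊔ r)
SamePredecessors E d e = ∀ z → E z d ⇔ E z e

module _ {ℓ : Level} where

  ∅ : 𝕍 ℓ
  ∅ = sup Empty λ ()

  Index : 𝕍 ℓ → Set ℓ
  Index (sup I f) = I

  component : (x : 𝕍 ℓ) → Index x → 𝕍 ℓ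
  component (sup I f) = f

  ∈-component : ∀ {x} (y : 𝕍 ℓ) → x ∈ y → ∃[ i ] x ≐ component y i
  ∈-component (sup I f) x∈y = x∈y

  ∈-respˡ : ∀ {x x′} (y : 𝕍 ℓ) → x ≐ x′ → x ∈ y → x′ ∈ y
  ∈-respˡ {x} {x′} (sup I f) x≐x′ (i , x≐) = i , ≐-trans x′ x _ (≐-sym x x′ x≐x′) x≐

  ∈-respʳ : ∀ {x} (y y′ : 𝕍 ℓ) → y ≐ y′ → x ∈ y → x ∈ y′
  ∈-respʳ {x} (sup I f) (sup J g) (p , _) (i , x≐) =
    let (j , e) = p i in j , ≐-trans x (f i) (g j) x≐ e

  ≐-ext : ∀ (x y : 𝕍 ℓ) → (∀ z → z ∈ x → z ∈ y) → (∀ z → z ∈ y → z ∈ x) → x ≐ y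
  ≐-ext (sup I f) (sup J g) x⊆y y⊆x =
    (λ i → x⊆y (f i) (i , ≐-refl (f i))) ,
    (λ j → let (i , e) = y⊆x (g j) (j , ≐-refl (g j)) in i , ≐-sym (g j) (f i) e)

  module _ (em : ∀ {a} → ExcludedMiddle a) {l} (x : 𝕍 ℓ) (φ : 𝕍 ℓ → Set l)
           (respects : ∀ {y z} → y ≐ z → φ y → φ z) where
    open Classical em

    separate : 𝕍 ℓ
    separate = sup (Σ[ i ∈ Index x ] ∥_∥ {ℓ = ℓ} (φ (component x i))) λ (i , _) → component x i

    separate-intro : ∀ {y} → y ∈ x → φ y → y ∈ separate
    separate-intro y∈x φy = let (i , e) = ∈-component x y∈x in (i , ∣ respects e φy ∣) , e

    separate-elim : ∀ {y} → y ∈ separate → φ y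
    separate-elim {y} ((i , p) , e) = respects (≐-sym y (component x i) e) (unbox p)

  module _ {c r} {C : Set c} (E : Rel C r) where

    collapse-≐ : ∀ {c} (x y : 𝕍 ℓ) → x ≐ y → Collapse E c x → Collapse E c y
    collapse-≐ (sup I f) (sup J g) (p , q) (into , onto) =
      (λ d dEc → let (i , col) = into d dEc ; (j , e) = p i in j , collapse-≐ (f i) (g j) e col) ,
      (λ j → let (i , e) = q j ; (d , dEc , col) = onto i in d , dEc , collapse-≐ (f i) (g j) e col)

    collapse-unique : ∀ {c} (x y : 𝕍 ℓ) → Collapse E c x → Collapse E c y → x ≐ y
    collapse-unique (sup I f) (sup J g) (into , onto) (into′ , onto′) =
      (λ i → let (d , dEc , col) = onto i ; (j , col′) = into′ d dEc in
        j , collapse-unique (f i) (g j) col col′) ,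
      (λ j → let (d , dEc , col′) = onto′ j ; (i , col) = into d dEc in
        i , collapse-unique (f i) (g j) col col′)

    collapse-acc : ∀ {c} (x : 𝕍 ℓ) → Collapse E c x → Acc E c
    collapse-acc (sup I f) (into , _) =
      acc λ {d} dEc → let (i , col) = into d dEc in collapse-acc (f i) col

    collapse-pred : ∀ {c d} (x : 𝕍 ℓ) → Collapse E c x → E d c → ∃[ y ] y ∈ x × Collapse E d y
    collapse-pred (sup I f) (into , _) dEc =
      let (i , col) = into _ dEc in f i , (i , ≐-refl (f i)) , col

    collapse-member : ∀ {c} (x y : 𝕍 ℓ) → Collapse E c x → y ∈ x → ∃[ d ] E d c × Collapse E d y
    collapse-member (sup I f) y (_ , onto) (i , e) =
      let (d , dEc , col) = onto i in d , dEc , collapse-≐ (f i) y (≐-sym y (f i) e) col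

    collapse-∈ : ∀ {c d} (x y : 𝕍 ℓ) → Collapse E c x → Collapse E d y → E d c → y ∈ x
    collapse-∈ x y colx coly dEc = let (y′ , y′∈x , col) = collapse-pred x colx dEc in
      ∈-respˡ x (collapse-unique y′ y col coly) y′∈x

    collapse-intro : ∀ {c} (x : 𝕍 ℓ) → (∀ d → E d c → ∃[ y ] y ∈ x × Collapse E d y) →
                     (∀ y → y ∈ x → ∃[ d ] E d c × Collapse E d y) → Collapse E c x
    collapse-intro (sup I f) into onto =
      (λ d dEc → let (y , (i , e) , col) = into d dEc in i , collapse-≐ y (f i) e col) ,
      (λ i → onto (f i) (i , ≐-refl (f i)))

    collapse-same : ∀ {c d} (x : 𝕍 ℓ) → SamePredecessors E c d → Collapse E c x → Collapse E d x
    collapse-same (sup I f) same (into , onto) =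
      (λ d dEc → into d (Equivalence.from (same d) dEc)) ,
      (λ i → let (d , dEc , col) = onto i in d , Equivalence.to (same d) dEc , col)

    -- By induction on the common value, predecessors with equal values are `∼` and can be
    -- exchanged; extensionality up to `∼` does the rest. It serves both names and functions on an
    -- antichain.
    collapse-injective :
      ∀ {s} (_∼_ : Rel C s) → Symmetric _∼_ →
      (∀ {c d e} → c ∼ d → E c e → E d e) →
      (∀ {c d} → (∀ e → E e c → E e d) → (∀ e → E e d → E e c) → c ∼ d) →
      ∀ {c d} (x : 𝕍 ℓ) → Collapse E c x → Collapse E d x → c ∼ d
    collapse-injective _∼_ ∼-sym respects extensional = go
      where
      go : ∀ {c d} (x : 𝕍 ℓ) → Collapse E c x → Collapse E d x → c ∼ d
      go (sup I f) (into , onto) (into′ , onto′) = extensional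
        (λ e eEc → let (i , col) = into e eEc ; (e′ , e′Ed , col′) = onto′ i in
          respects (∼-sym (go (f i) col col′)) e′Ed)
        (λ e eEd → let (i , col) = into′ e eEd ; (e′ , e′Ec , col′) = onto i in
          respects (∼-sym (go (f i) col col′)) e′Ec)

    module _ (em : ∀ {a} → ExcludedMiddle a)
             (Cover : C → Set ℓ) (cover : ∀ c → Cover c → C)
             (covers : ∀ {c d} → E d c →
               ∃[ k ] E (cover c k) c × SamePredecessors E (cover c k) d)
             where
      open Classical em

      -- C may be a large type, so a value cannot be indexed by all predecessors of c. `covers`
      -- makes E set-like: the small family `Cover c` meets every predecessor up to
      -- `SamePredecessors`, which does not change the collapse.
      collapse-exists : ∀ {c} → Acc E c → ∃ {A = 𝕍 ℓ} (Collapse E c)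
      collapse-exists {c} (acc rs) =
        sup (Σ[ k ∈ Cover c ] ∥_∥ {ℓ = ℓ} (E (cover c k) c))
          (λ (k , p) → proj₁ (collapse-exists (rs (unbox p)))) ,
        -- The value at index `(k , p′)` was computed from `unbox p′`, which need not be the proof
        -- `p` itself.
        (λ d dEc → let (k , p , same) = covers dEc ; p′ = ∣_∣ {ℓ = ℓ} p in
          (k , p′) , collapse-same _ same (proj₂ (collapse-exists (rs (unbox p′))))) ,
        (λ (k , p) → cover c k , unbox p , proj₂ (collapse-exists (rs (unbox p))))

-- Reasoning inside a complete Boolean algebra.

-- Kripke–Joyal style: b is handled through the generalised elements v ≤ b.
module Internal {ℓ} (B : CompleteBooleanAlgebra ℓ) where
  open CompleteBooleanAlgebra B
    renaming (trans to ≤-trans; refl to ≤-refl)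

  ∧-elimˡ : ∀ {v a b} → v ≤ a ∧ b → v ≤ a
  ∧-elimˡ p = ≤-trans p (x∧y≤x _ _)

  ∧-elimʳ : ∀ {v a b} → v ≤ a ∧ b → v ≤ b
  ∧-elimʳ p = ≤-trans p (x∧y≤y _ _)

  ⇨-intro : ∀ {v a b} → (∀ w → w ≤ v → w ≤ a → w ≤ b) → v ≤ a ⇨ b
  ⇨-intro f = transpose-⇨ (f _ (x∧y≤x _ _) (x∧y≤y _ _))

  ⇨-elim : ∀ {v a b} → v ≤ a ⇨ b → v ≤ a → v ≤ b
  ⇨-elim p q = ≤-trans (∧-greatest p q) (transpose-∧ ≤-refl)

  ∨-elim : ∀ {v a b c} → v ≤ a ∨ b → (∀ w → w ≤ v → w ≤ a → w ≤ c) →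
           (∀ w → w ≤ v → w ≤ b → w ≤ c) → v ≤ c
  ∨-elim p f g = ⇨-elim (≤-trans p (∨-least
    (⇨-intro λ w w≤a w≤v → f w w≤v w≤a) (⇨-intro λ w w≤b w≤v → g w w≤v w≤b))) ≤-refl

  ⋁-intro : ∀ {I : Set ℓ} (f : I → Carrier) i {v} → v ≤ f i → v ≤ ⋁ f
  ⋁-intro f i p = ≤-trans p (proj₁ (⋁-lub f) i)

  ⋁-elim : ∀ {I : Set ℓ} (f : I → Carrier) {v c} → v ≤ ⋁ f →
           (∀ i w → w ≤ v → w ≤ f i → w ≤ c) → v ≤ c
  ⋁-elim f p g = ⇨-elim (≤-trans p (proj₂ (⋁-lub f) _ λ i →
    ⇨-intro λ w w≤fi w≤v → g i w w≤v w≤fi)) ≤-refl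

  ⋀-intro : ∀ {I : Set ℓ} (f : I → Carrier) {v} → (∀ i → v ≤ f i) → v ≤ ⋀ f
  ⋀-intro f = proj₂ (⋀-glb f) _

  ⋀-elim : ∀ {I : Set ℓ} (f : I → Carrier) {v} → v ≤ ⋀ f → ∀ i → v ≤ f i
  ⋀-elim f p i = ≤-trans p (proj₁ (⋀-glb f) i)

  ∁-intro : ∀ {v a} → (∀ w → w ≤ v → w ≤ a → w ≤ 𝟎) → v ≤ ∁ a
  ∁-intro f = ≤-trans (⇨-intro f) (∨-least ≤-refl (minimum _))

  ∁-elim : ∀ {v a b} → v ≤ ∁ a → v ≤ a → v ≤ b
  ∁-elim p q = ≤-trans (⇨-elim (≤-trans p (x≤x∨y _ _)) q) (minimum _)

  -- In a Boolean algebra `a ⇨ a` is by definition `∁ a ∨ a`, so the trivial implication yields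
  -- excluded middle.
  by-cases : ∀ a {v c} → (∀ w → w ≤ v → w ≤ a → w ≤ c) → (∀ w → w ≤ v → w ≤ ∁ a → w ≤ c) → v ≤ c
  by-cases a f g = ∨-elim (⇨-intro {a = a} λ _ _ p → p) (λ w w≤v p → g w w≤v p) (λ w w≤v p → f w w≤v p)

-- Boolean-valued names, mixtures and pairs.

module Names {ℓ : Level} (em : ∀ {a} → ExcludedMiddle a)
             (P : Poset ℓ ℓ ℓ) (C : Completion P)
             (U : Ultrafilter (Completion.algebra C)) where

  open Classical em
  open BooleanUltrapower P C U hiding (j_≐_)
  open Completion C
  open CompleteBooleanAlgebra algebra renaming (Carrier to 𝔹; refl to ≤-refl; trans to ≤-trans)
  open Internal algebra

  Dom : Name → Set ℓ
  elt : (σ : Name) → Dom σ → Name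
  wt : (σ : Name) → Dom σ → 𝔹

  Dom (name I σ b) = I
  elt (name I σ b) = σ
  wt (name I σ b) = b

  infix 5 _≐̇_ _∈̇_
  infix 4 _⊩_

  data Formula : Set (suc ℓ) where
    _≐̇_ _∈̇_ : Name → Name → Formula

  value : Formula → 𝔹
  value (σ ≐̇ τ) = ⟦ σ ≐ τ ⟧
  value (σ ∈̇ τ) = ⟦ σ ∈ τ ⟧

  -- A wrapper, so that the formula can be inferred from its truth value.
  record _⊩_ (v : 𝔹) (φ : Formula) : Set ℓ where
    constructor forced
    field force : v ≤ value φ

  open _⊩_ public

  weaken : ∀ {v w φ} → w ≤ v → v ⊩ φ → w ⊩ φ
  weaken w≤v p = forced (≤-trans w≤v (force p))

  ∈-intro : ∀ τ (j : Dom τ) {σ v} → v ≤ wt τ j → v ⊩ σ ≐̇ elt τ j → v ⊩ σ ∈̇ τ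
  ∈-intro (name J τ c) j p q = forced (⋁-intro _ j (∧-greatest p (force q)))

  ∈-elim : ∀ {σ τ v c} → v ⊩ σ ∈̇ τ →
           (∀ (j : Dom τ) w → w ≤ v → w ≤ wt τ j → w ⊩ σ ≐̇ elt τ j → w ≤ c) → v ≤ c
  ∈-elim {τ = name J τ c} p f =
    ⋁-elim _ (force p) λ j w w≤v q → f j w w≤v (∧-elimˡ q) (forced (∧-elimʳ q))

  ∈-elim⊩ : ∀ {σ τ v φ} → v ⊩ σ ∈̇ τ →
            (∀ (j : Dom τ) w → w ≤ v → w ≤ wt τ j → w ⊩ σ ≐̇ elt τ j → w ⊩ φ) → v ⊩ φ
  ∈-elim⊩ p f = forced (∈-elim p λ j w w≤v q r → force (f j w w≤v q r))

  private
    -- The second conjunct of `⟦_≐_⟧` compares `elt σ i` with `elt τ j` in this order, so it becomes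
    -- a membership in σ only once symmetry is proved; see `≐-intro`.
    ≐-intro′ : ∀ σ τ {v} → (∀ (i : Dom σ) w → w ≤ v → w ≤ wt σ i → w ⊩ elt σ i ∈̇ τ) →
               (∀ (j : Dom τ) w → w ≤ v → w ≤ wt τ j →
                 w ≤ ⋁ {I = Dom σ} λ i → wt σ i ∧ ⟦ elt σ i ≐ elt τ j ⟧) →
               v ⊩ σ ≐̇ τ
    ≐-intro′ (name I σ b) (name J τ c) f g = forced (∧-greatest
      (⋀-intro _ λ i → ⇨-intro λ w p q → force (f i w p q)) (⋀-intro _ λ j → ⇨-intro (g j)))

    ≐-elimʳ : ∀ σ τ {v} → v ⊩ σ ≐̇ τ → ∀ (j : Dom τ) → v ≤ wt τ j →
              v ≤ ⋁ {I = Dom σ} λ i → wt σ i ∧ ⟦ elt σ i ≐ elt τ j ⟧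
    ≐-elimʳ (name I σ b) (name J τ c) p j = ⇨-elim (⋀-elim _ (∧-elimʳ (force p)) j)

  ≐-elim : ∀ σ τ {v} → v ⊩ σ ≐̇ τ → ∀ (i : Dom σ) → v ≤ wt σ i → v ⊩ elt σ i ∈̇ τ
  ≐-elim (name I σ b) (name J τ c) p i q = forced (⇨-elim (⋀-elim _ (∧-elimˡ (force p)) i) q)

  name-refl : ∀ σ {v} → v ⊩ σ ≐̇ σ
  name-refl σ@(name I f b) = ≐-intro′ σ σ
    (λ i w _ p → ∈-intro σ i p (name-refl (f i)))
    (λ i w _ p → ⋁-intro _ i (∧-greatest p (force (name-refl (f i)))))

  name-sym : ∀ {σ τ v} → v ⊩ σ ≐̇ τ → v ⊩ τ ≐̇ σ
  name-sym {σ@(name I f b)} {τ@(name J g c)} p = ≐-intro′ τ σ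
    (λ j w w≤v q → forced (⋁-elim _ (≐-elimʳ σ τ (weaken w≤v p) j q) λ i u _ r →
      force (∈-intro σ i (∧-elimˡ r) (name-sym {f i} {g j} (forced (∧-elimʳ r))))))
    (λ i w w≤v q → ∈-elim (≐-elim σ τ (weaken w≤v p) i q) λ j u _ r s →
      ⋁-intro _ j (∧-greatest r (force (name-sym {f i} {g j} s))))

  name-trans : ∀ {σ τ ρ v} → v ⊩ σ ≐̇ τ → v ⊩ τ ≐̇ ρ → v ⊩ σ ≐̇ ρ
  name-trans {σ@(name I f b)} {τ@(name J g c)} {ρ@(name K h d)} p q = ≐-intro′ σ ρ
    (λ i w w≤v r → ∈-elim⊩ (≐-elim σ τ (weaken w≤v p) i r) λ j u u≤w s e →
      ∈-elim⊩ (≐-elim τ ρ (weaken (≤-trans u≤w w≤v) q) j s) λ k t t≤u s′ e′ →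
      ∈-intro ρ k s′ (name-trans {f i} {g j} {h k} (weaken t≤u e) e′))
    (λ k w w≤v r → ⋁-elim _ (≐-elimʳ τ ρ (weaken w≤v q) k r) λ j u u≤w s →
      ⋁-elim _ (≐-elimʳ σ τ (weaken (≤-trans u≤w w≤v) p) j (∧-elimˡ s)) λ i t t≤u e →
      ⋁-intro _ i (∧-greatest (∧-elimˡ e)
        (force (name-trans {f i} {g j} {h k} (forced (∧-elimʳ e)) (weaken t≤u (forced (∧-elimʳ s)))))))

  ≐-intro : ∀ σ τ {v} → (∀ (i : Dom σ) w → w ≤ v → w ≤ wt σ i → w ⊩ elt σ i ∈̇ τ) →
            (∀ (j : Dom τ) w → w ≤ v → w ≤ wt τ j → w ⊩ elt τ j ∈̇ σ) → v ⊩ σ ≐̇ τ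
  ≐-intro σ τ f g = ≐-intro′ σ τ f λ j w w≤v p → ∈-elim (g j w w≤v p) λ i u _ q r →
    ⋁-intro _ i (∧-greatest q (force (name-sym r)))

  ∈-replaceˡ : ∀ {σ σ′ τ v} → v ⊩ σ ≐̇ σ′ → v ⊩ σ ∈̇ τ → v ⊩ σ′ ∈̇ τ
  ∈-replaceˡ {τ = τ} p q = ∈-elim⊩ q λ j w w≤v r s →
    ∈-intro τ j r (name-trans (name-sym (weaken w≤v p)) s)

  ∈-replaceʳ : ∀ {σ τ τ′ v} → v ⊩ τ ≐̇ τ′ → v ⊩ σ ∈̇ τ → v ⊩ σ ∈̇ τ′
  ∈-replaceʳ {τ = τ} {τ′} p q = ∈-elim⊩ q λ j w w≤v r s →
    ∈-replaceˡ (name-sym s) (≐-elim τ τ′ (weaken w≤v p) j r)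

  check-≐ : ∀ x y → x ≐ y → ∀ {v} → v ⊩ check x ≐̇ check y
  check-≐ x@(sup I f) y@(sup J g) (p , q) = ≐-intro (check x) (check y)
    (λ i w _ _ → let (j , e) = p i in ∈-intro (check y) j (maximum w) (check-≐ (f i) (g j) e))
    (λ j w _ _ → let (i , e) = q j in
      ∈-intro (check x) i (maximum w) (name-sym (check-≐ (f i) (g j) e)))

  check-≐̸ : ∀ x y → ¬ (x ≐ y) → ∀ {v c} → v ⊩ check x ≐̇ check y → v ≤ c
  check-≐̸ x@(sup I f) y@(sup J g) x≐̸y {v} {c} p with em {P = ∀ i → ∃[ j ] f i ≐ g j}
  ... | no ¬all = ∈-elim (≐-elim (check x) (check y) p i (maximum v)) λ j w _ _ q →
          check-≐̸ (f i) (g j) (λ e → f≐̸g (j , e)) q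
    where
    counterexample : ∃[ i ] ¬ (∃[ j ] f i ≐ g j)
    counterexample = by-contradiction λ none → ¬all λ i → by-contradiction λ ¬j → none (i , ¬j)
    i = proj₁ counterexample
    f≐̸g = proj₂ counterexample
  ... | yes all = ∈-elim (≐-elim (check y) (check x) (name-sym p) j (maximum v)) λ i w _ _ q →
          check-≐̸ (f i) (g j) (λ e → f≐̸g (i , e)) (name-sym q)
    where
    counterexample : ∃[ j ] ¬ (∃[ i ] f i ≐ g j)
    counterexample = by-contradiction λ none → x≐̸y (all , λ j → by-contradiction λ ¬i → none (j , ¬i))
    j = proj₁ counterexample
    f≐̸g = proj₂ counterexample

  ∈-check-elim : ∀ x {σ v c} → v ⊩ σ ∈̇ check x →
                 (∀ i w → w ≤ v → w ⊩ σ ≐̇ check (component x i) → w ≤ c) → v ≤ c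
  ∈-check-elim (sup I f) p g = ∈-elim p λ i w w≤v _ q → g i w w≤v q

  check-∈ : ∀ x y → x ∈ y → ∀ {v} → v ⊩ check x ∈̇ check y
  check-∈ x (sup J g) (j , e) {v} = ∈-intro _ j (maximum v) (check-≐ x (g j) e)

  check-∉ : ∀ x y → ¬ (x ∈ y) → ∀ {v c} → v ⊩ check x ∈̇ check y → v ≤ c
  check-∉ x (sup J g) x∉y p = ∈-elim p λ j w _ _ q → check-≐̸ x (g j) (λ e → x∉y (j , e)) q

  ∈Ġ-intro : ∀ b {v} → v ≤ b → v ⊩ check ⌜ b ⌝ ∈̇ Ġ
  ∈Ġ-intro b p = ∈-intro Ġ b p (name-refl (check ⌜ b ⌝))

  -- With `∈Ġ-intro`, b is exactly the value of its own code lying in `Ġ`. Injectivity of `code`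
  -- prevents other elements of 𝔹 from contributing to it.
  ∈Ġ-elim : ∀ b {v} → v ⊩ check ⌜ b ⌝ ∈̇ Ġ → v ≤ b
  ∈Ġ-elim b p = ∈-elim p λ c w _ → distinguish c w
    where
    distinguish : ∀ c w → w ≤ c → w ⊩ check ⌜ b ⌝ ≐̇ check ⌜ c ⌝ → w ≤ b
    distinguish c w w≤c q with em {P = ⌜ b ⌝ ≐ ⌜ c ⌝}
    ... | yes e = ≤-trans w≤c (reflexive (Eq.sym (Injection.injective code e)))
    ... | no ¬e = check-≐̸ ⌜ b ⌝ ⌜ c ⌝ ¬e q

  Coherent : {J : Set ℓ} → (J → 𝔹) → (J → Name) → Set ℓ
  Coherent u σ = ∀ j j′ {v} → v ≤ u j → v ≤ u j′ → v ⊩ σ j ≐̇ σ j′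

  mix : {J : Set ℓ} → (J → 𝔹) → (J → Name) → Name
  mix {J} u σ = name (Σ[ j ∈ J ] Dom (σ j)) (λ (j , i) → elt (σ j) i) (λ (j , i) → u j ∧ wt (σ j) i)

  -- The mixing lemma without an antichain: the weights may overlap as long as the names agree on
  -- the overlaps.
  mix-≐ : {J : Set ℓ} (u : J → 𝔹) (σ : J → Name) → Coherent u σ →
          ∀ j {v} → v ≤ u j → v ⊩ mix u σ ≐̇ σ j
  mix-≐ u σ coherent j p = ≐-intro (mix u σ) (σ j)
    (λ (j′ , i) w w≤v q → ∈-replaceʳ
      (coherent j′ j (∧-elimˡ q) (≤-trans w≤v p))
      (∈-intro (σ j′) i (∧-elimʳ q) (name-refl _)))
    (λ i w w≤v q → ∈-intro (mix u σ) (j , i)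
      (∧-greatest (≤-trans w≤v p) q) (name-refl _))

  -- Up to Boolean value, the members of τ are the names select τ u.
  select : (τ : Name) → (Dom τ → 𝔹) → Name
  select τ u = mix u (elt τ)

  member-weights : (d τ : Name) → Dom τ → 𝔹
  member-weights d τ j = wt τ j ∧ ⟦ d ≐ elt τ j ⟧

  -- The weights are coherent because two elements of τ that both equal d equal each other. As
  -- weight functions on `Dom τ` form a set, the relation E is set-like up to Boolean equality.
  select-≐ : ∀ {d τ v} → v ⊩ d ∈̇ τ → v ⊩ select τ (member-weights d τ) ≐̇ d
  select-≐ {d} {τ} p = ∈-elim⊩ p λ j w _ q r →
    name-trans
      (mix-≐ (member-weights d τ) (elt τ)
        (λ i i′ s t → name-trans (name-sym {d} (forced (∧-elimʳ s))) (forced {φ = d ≐̇ _} (∧-elimʳ t)))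
        j (∧-greatest q (force r)))
      (name-sym r)

  upair : Name → Name → Name
  upair σ τ = name (Lift ℓ Bool) (λ { (lift true) → σ ; (lift false) → τ }) (λ _ → 𝟏)

  pair : Name → Name → Name
  pair σ τ = upair (upair σ σ) (upair σ τ)

  ∈-upairˡ : ∀ {σ τ d v} → v ⊩ d ≐̇ σ → v ⊩ d ∈̇ upair σ τ
  ∈-upairˡ = ∈-intro (upair _ _) (lift true) (maximum _)

  ∈-upairʳ : ∀ {σ τ d v} → v ⊩ d ≐̇ τ → v ⊩ d ∈̇ upair σ τ
  ∈-upairʳ = ∈-intro (upair _ _) (lift false) (maximum _)

  ∈-upair-elim : ∀ {σ τ d v φ} → v ⊩ d ∈̇ upair σ τ → (∀ w → w ≤ v → w ⊩ d ≐̇ σ → w ⊩ φ) →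
                 (∀ w → w ≤ v → w ⊩ d ≐̇ τ → w ⊩ φ) → v ⊩ φ
  ∈-upair-elim p f g = ∈-elim⊩ p λ
    { (lift true) w w≤v _ q → f w w≤v q ; (lift false) w w≤v _ q → g w w≤v q }

  ∈-singleton : ∀ {σ d v} → v ⊩ d ∈̇ upair σ σ → v ⊩ d ≐̇ σ
  ∈-singleton p = ∈-upair-elim p (λ _ _ q → q) (λ _ _ q → q)

  upair-cong : ∀ {σ τ σ′ τ′ v} → v ⊩ σ ≐̇ σ′ → v ⊩ τ ≐̇ τ′ → v ⊩ upair σ τ ≐̇ upair σ′ τ′
  upair-cong p q = ≐-intro (upair _ _) (upair _ _)
    (λ { (lift true) w w≤v _ → ∈-upairˡ (weaken w≤v p)
       ; (lift false) w w≤v _ → ∈-upairʳ (weaken w≤v q) })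
    (λ { (lift true) w w≤v _ → ∈-upairˡ (name-sym (weaken w≤v p))
       ; (lift false) w w≤v _ → ∈-upairʳ (name-sym (weaken w≤v q)) })

  pair-cong : ∀ {σ τ σ′ τ′ v} → v ⊩ σ ≐̇ σ′ → v ⊩ τ ≐̇ τ′ → v ⊩ pair σ τ ≐̇ pair σ′ τ′
  pair-cong p q = upair-cong (upair-cong p p) (upair-cong p q)

  check-upair : ∀ x y {v} → v ⊩ check ｛ x , y ｝ ≐̇ upair (check x) (check y)
  check-upair x y = ≐-intro (check ｛ x , y ｝) (upair (check x) (check y))
    (λ { (lift true) w _ _ → ∈-upairˡ (name-refl (check x))
       ; (lift false) w _ _ → ∈-upairʳ (name-refl (check y)) })
    (λ { (lift true) w _ _ → check-∈ x ｛ x , y ｝ (lift true , ≐-refl x)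
       ; (lift false) w _ _ → check-∈ y ｛ x , y ｝ (lift false , ≐-refl y) })

  check-pair : ∀ x y {v} → v ⊩ check ⟪ x , y ⟫ ≐̇ pair (check x) (check y)
  check-pair x y = name-trans
    (check-upair ｛ x , x ｝ ｛ x , y ｝) (upair-cong (check-upair x x) (check-upair x y))

  private
    upair-∈ˡ : ∀ {σ τ ρ v} → v ⊩ upair σ τ ≐̇ ρ → v ⊩ σ ∈̇ ρ
    upair-∈ˡ p = ∈-replaceʳ p (∈-upairˡ (name-refl _))

    upair-∈ʳ : ∀ {σ τ ρ v} → v ⊩ upair σ τ ≐̇ ρ → v ⊩ τ ∈̇ ρ
    upair-∈ʳ p = ∈-replaceʳ p (∈-upairʳ (name-refl _))

  pair-injˡ : ∀ {σ τ σ′ τ′ v} → v ⊩ pair σ τ ≐̇ pair σ′ τ′ → v ⊩ σ ≐̇ σ′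
  pair-injˡ p = ∈-upair-elim (upair-∈ˡ p)
    (λ w _ q → ∈-singleton (upair-∈ˡ q))
    (λ w _ q → name-sym (∈-singleton (upair-∈ˡ (name-sym q))))

  pair-injʳ : ∀ {σ τ σ′ τ′ v} → v ⊩ pair σ τ ≐̇ pair σ′ τ′ → v ⊩ τ ≐̇ τ′
  pair-injʳ {σ} {τ} {σ′} {τ′} {v} p = ∈-upair-elim (upair-∈ʳ p)
    (λ w w≤v q → degenerate w w≤v (∈-singleton (upair-∈ʳ q)))
    (λ w w≤v q → ∈-upair-elim (upair-∈ʳ q)
      (λ u u≤w → degenerate u (≤-trans u≤w w≤v)) (λ _ _ r → r))
    where
    -- If τ equals σ′, then all entries of the first pair equal σ, and hence so does τ′.
    degenerate : ∀ w → w ≤ v → w ⊩ τ ≐̇ σ′ → w ⊩ τ ≐̇ τ′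
    degenerate w w≤v τ≐σ′ = name-trans τ≐σ (name-sym τ′≐σ)
      where
      p′ = weaken w≤v p
      τ≐σ : w ⊩ τ ≐̇ σ
      τ≐σ = name-trans τ≐σ′ (name-sym (pair-injˡ p′))
      τ′≐σ : w ⊩ τ′ ≐̇ σ
      τ′≐σ = ∈-upair-elim (upair-∈ʳ (name-sym p′))
        (λ u _ q → ∈-singleton (upair-∈ʳ q))
        (λ u u≤w q → ∈-upair-elim (upair-∈ʳ q) (λ _ _ r → r)
          (λ t t≤u r → name-trans r (weaken (≤-trans t≤u u≤w) τ≐σ)))

-- Density, maximal antichains and truth modulo U.

module Ultrapowers {ℓ : Level} (em : ∀ {a} → ExcludedMiddle a) (ac : AxiomOfChoice ℓ)
                   (P : Poset ℓ ℓ ℓ) (C : Completion P)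
                   (U : Ultrafilter (Completion.algebra C)) where

  open Classical em
  open BooleanUltrapower P C U hiding (j_≐_)
  open Completion C
  open CompleteBooleanAlgebra algebra
    using (𝟏; 𝟎; _≈_; _≤_; _∧_; ∁_; ⋁; ∧-greatest; maximum; minimum; reflexive; antisym; module Eq)
    renaming (Carrier to 𝔹; refl to ≤-refl; trans to ≤-trans)
  open Internal algebra
  open Names em P C U
  open MaximalAntichain using (elements)
  open Equivalence using (to; from)
  private
    module P = Poset P
    module U = Ultrafilter U
    module ι = IsOrderMonomorphism ι-embedding

  -- Otherwise the part of v outside c is nonzero, so it lies above a condition, and this condition
  -- has no extension below c.
  dense-≤ : ∀ {v c} → (∀ p → ι p ≤ v → ∃[ q ] q P.≤ p × ι q ≤ c) → v ≤ c
  dense-≤ {v} {c} below = by-cases c (λ w _ w≤c → w≤c) λ w w≤v w≤∁c → by-contradiction λ w≰c →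
    let (p , p≤w)       = ι-dense w (λ w≈𝟎 → w≰c (≤-trans (reflexive w≈𝟎) (minimum c)))
        (q , q≤p , q≤c) = below p (≤-trans p≤w w≤v)
    in ι-nonzero q (antisym (∁-elim (≤-trans (ι.mono q≤p) (≤-trans p≤w w≤∁c)) q≤c) (minimum _))

  incompatible-∧ : ∀ {p q v c} → _⊥_ P p q → v ≤ ι p → v ≤ ι q → v ≤ c
  incompatible-∧ p⊥q v≤p v≤q = dense-≤ λ r r≤v →
    contradiction (r , ι.cancel (≤-trans r≤v v≤p) , ι.cancel (≤-trans r≤v v≤q)) p⊥q

  -- Take a maximal clique of incompatibility within D. If a larger antichain had a further element
  -- p, an extension of p in D would be incompatible with the whole clique, hence belong to it, and
  -- so be incompatible with itself.
  antichain-in : (D : Pred P.Carrier ℓ) → (∀ {p q} → q P.≤ p → D p → D q) →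
                 (∀ p → ∃[ q ] q P.≤ p × D q) → ∃[ A ] elements {P = P} A ⊆ D
  antichain-in D open′ dense = A , λ (x , _ , p≈x) → open′ (P.reflexive p≈x) (proj₂ x)
    where
    ⊥-sym : ∀ {p q} → _⊥_ P p q → _⊥_ P q p
    ⊥-sym p⊥q (r , r≤q , r≤p) = p⊥q (r , r≤p , r≤q)

    open MaximalClique ac {X = ∃ D} (_⊥_ P on proj₁) ⊥-sym

    member : Pred P.Carrier ℓ
    member p = ∃[ x ] clique x ≡ true × p P.≈ proj₁ x

    A : MaximalAntichain P
    A = record
      { elements    = member
      ; isAntichain = record
        { respects     = λ p≈q (x , x∈ , p≈x) → x , x∈ , P.Eq.trans (P.Eq.sym p≈q) p≈x
        ; incompatible = λ (x , x∈ , p≈x) (y , y∈ , q≈y) p≉q (r , r≤p , r≤q) →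
            clique-related x y x∈ y∈ (λ { refl → p≉q (P.Eq.trans p≈x (P.Eq.sym q≈y)) })
              (r , P.trans r≤p (P.reflexive p≈x) , P.trans r≤q (P.reflexive q≈y))
        }
      ; maximal = λ A′ antichain member⊆A′ {p} p∈A′ → by-contradiction λ p∉ →
          let open IsAntichain antichain
              (q , q≤p , Dq) = dense p
              related : ∀ y → clique y ≡ _ → _⊥_ P q (proj₁ y)
              related y y∈ (r , r≤q , r≤y) = incompatible p∈A′ (member⊆A′ (y , y∈ , P.Eq.refl))
                (λ p≈y → p∉ (y , y∈ , p≈y)) (r , P.trans r≤q q≤p , r≤y)
              q∈ = clique-maximal (q , Dq) related
          in related (q , Dq) q∈ (q , P.refl , P.refl)
      }

  infix 3 ⊨_

  record ⊨_ (φ : Formula) : Set ℓ where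
    constructor valid
    field holds : U.member (value φ)

  open ⊨_ public

  ⊨-map : ∀ {φ ψ} → (∀ {v} → v ⊩ φ → v ⊩ ψ) → ⊨ φ → ⊨ ψ
  ⊨-map f p = valid (U.upward (force (f (forced ≤-refl))) (holds p))

  ⊨-zip : ∀ {φ ψ χ} → (∀ {v} → v ⊩ φ → v ⊩ ψ → v ⊩ χ) → ⊨ φ → ⊨ ψ → ⊨ χ
  ⊨-zip f p q = valid (U.upward
    (force (f (forced (∧-elimˡ ≤-refl)) (forced (∧-elimʳ ≤-refl)))) (U.meet (holds p) (holds q)))

  ⊨-intro : ∀ {φ b} → U.member b → (∀ {v} → v ≤ b → v ⊩ φ) → ⊨ φ
  ⊨-intro p f = valid (U.upward (force (f ≤-refl)) p)

  U-clash : ∀ {a b} → U.member a → U.member b → ¬ (∀ v → v ≤ a → v ≤ b → v ≤ 𝟎)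
  U-clash p q disjoint =
    U.proper (U.upward (disjoint _ (∧-elimˡ ≤-refl) (∧-elimʳ ≤-refl)) (U.meet p q))

  U-∁ : ∀ {a} → ¬ U.member a → U.member (∁ a)
  U-∁ {a} ¬a = [ (λ a∈ → contradiction a∈ ¬a) , (λ p → p) ]′ (U.ultra a)

  infix 4 _∼_

  _∼_ : Rel Name ℓ
  σ ∼ τ = ⊨ σ ≐̇ τ

  ∼-intro : ∀ {σ τ} → (∀ {v} → v ⊩ σ ≐̇ τ) → σ ∼ τ
  ∼-intro p = ⊨-intro U.top λ _ → p

  ∼-sym : ∀ {σ τ} → σ ∼ τ → τ ∼ σ
  ∼-sym = ⊨-map name-sym

  ⊨∈-respˡ : ∀ {σ σ′ τ} → σ ∼ σ′ → ⊨ σ ∈̇ τ → ⊨ σ′ ∈̇ τ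
  ⊨∈-respˡ = ⊨-zip ∈-replaceˡ

  ⊨∈-respʳ : ∀ {σ τ τ′} → τ ∼ τ′ → ⊨ σ ∈̇ τ → ⊨ σ ∈̇ τ′
  ⊨∈-respʳ = ⊨-zip ∈-replaceʳ

  ∼-same : ∀ {σ τ} → σ ∼ τ → SamePredecessors _E_ σ τ
  ∼-same {σ} {τ} σ∼τ z = mk⇔
    (λ p → holds (⊨∈-respʳ σ∼τ (valid {z ∈̇ σ} p)))
    (λ p → holds (⊨∈-respʳ (∼-sym σ∼τ) (valid {z ∈̇ τ} p)))

  infix 4 _↦_

  record _↦_ (σ : Name) (x : 𝕍 ℓ) : Set (suc ℓ) where
    constructor collapses
    field collapse : [ σ ]≐ x

  open _↦_ public

  ↦-resp : ∀ {σ τ x} → σ ∼ τ → σ ↦ x → τ ↦ x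
  ↦-resp {σ} {τ} {x} σ∼τ p = collapses (collapse-same _E_ {σ} {τ} x (∼-same σ∼τ) (collapse p))

  ↦-≐ : ∀ {σ x y} → x ≐ y → σ ↦ x → σ ↦ y
  ↦-≐ {x = x} {y} x≐y p = collapses (collapse-≐ _E_ x y x≐y (collapse p))

  ↦-unique : ∀ {σ x y} → σ ↦ x → σ ↦ y → x ≐ y
  ↦-unique {x = x} {y} p q = collapse-unique _E_ x y (collapse p) (collapse q)

  truth : ∀ {a} → Set a → 𝔹
  truth φ with em {P = φ}
  ... | yes _ = 𝟏
  ... | no _  = 𝟎

  truth-intro : ∀ {a} {φ : Set a} {v} → φ → v ≤ truth φ
  truth-intro {φ = φ} x with em {P = φ}
  ... | yes _ = maximum _
  ... | no ¬x = contradiction x ¬x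

  truth-elim : ∀ {a} {φ : Set a} {v c} → v ≤ truth φ → (φ → v ≤ c) → v ≤ c
  truth-elim {φ = φ} p f with em {P = φ}
  ... | yes x = f x
  ... | no _  = ≤-trans p (minimum _)

  -- The ultrapower by a maximal antichain and its embedding in the Boolean ultrapower.

  module OnAntichain (A : MaximalAntichain P) where

    ∣A∣ : Set ℓ
    ∣A∣ = ∃ (elements A)

    -- Points of `∣A∣` carry membership proofs and are compared by a setoid equality. Evaluating at
    -- representatives admits functions obtained by choice, which come without a congruence proof.
    rep : ∣A∣ → ∣A∣
    rep = canonical ac (Sub (elements A))

    rep-≈ : ∀ a → proj₁ (rep a) P.≈ proj₁ a
    rep-≈ = canonical-≈ ac (Sub (elements A))

    ι̂ : ∣A∣ → 𝔹
    ι̂ = ι ∘ proj₁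

    ι̂-rep : ∀ a {v} → v ≤ ι̂ a → v ≤ ι̂ (rep a)
    ι̂-rep a p = ≤-trans p (ι.mono (P.reflexive (P.Eq.sym (rep-≈ a))))

    -- The join of A is 𝟏. If p below v had no extension below c, then p would be incompatible with
    -- all of A, hence by maximality a member of A, and yet compatible with itself.
    antichain-cases : ∀ {v c} → (∀ a w → w ≤ v → w ≤ ι̂ a → w ≤ c) → v ≤ c
    antichain-cases {v} {c} f = dense-≤ λ p p≤v → by-contradiction λ none →
      let meets : ∀ {a} → elements A a → ∀ r → r P.≤ p → r P.≤ a → False
          meets = λ {a} a∈A r r≤p r≤a →
            none (r , r≤p , f (a , a∈A) (ι r) (≤-trans (ι.mono r≤p) p≤v) (ι.mono r≤a))
          open IsAntichain (MaximalAntichain.isAntichain A)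
          p∈A = MaximalAntichain.maximal A (λ q → elements A q ⊎ q P.≈ p) (record
            { respects = λ q≈r → [ inj₁ ∘ respects q≈r , inj₂ ∘ P.Eq.trans (P.Eq.sym q≈r) ]′
            ; incompatible = λ
              { (inj₁ q∈) (inj₁ r∈) → incompatible q∈ r∈
              ; (inj₁ q∈) (inj₂ r≈p) _ (s , s≤q , s≤r) →
                  meets q∈ s (P.trans s≤r (P.reflexive r≈p)) s≤q
              ; (inj₂ q≈p) (inj₁ r∈) _ (s , s≤q , s≤r) →
                  meets r∈ s (P.trans s≤q (P.reflexive q≈p)) s≤r
              ; (inj₂ q≈p) (inj₂ r≈p) q≉r _ → q≉r (P.Eq.trans q≈p (P.Eq.sym r≈p))
              }
            }) inj₁ (inj₂ P.Eq.refl)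
      in meets p∈A p P.refl P.refl

    meeting : ∀ a a′ {v c} → v ≤ ι̂ a → v ≤ ι̂ a′ → (rep a ≡ rep a′ → v ≤ c) → v ≤ c
    meeting a a′ p q f with em {P = proj₁ a P.≈ proj₁ a′}
    ... | yes a≈a′ = f (canonical-≡ ac (Sub (elements A)) a≈a′)
    ... | no a≉a′  = incompatible-∧
      (IsAntichain.incompatible (MaximalAntichain.isAntichain A) (proj₂ a) (proj₂ a′) a≉a′) p q

    -- The element of 𝔹 that agrees with `h (rep a)` below `ι̂ a`. That it lies in U extends "for
    -- almost all a" from truth values to Boolean values.
    glue : (∣A∣ → 𝔹) → 𝔹
    glue h = ⋁ λ a → ι̂ a ∧ h (rep a)

    glue-elim : ∀ h a {v} → v ≤ ι̂ a → v ≤ glue h → v ≤ h (rep a)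
    glue-elim h a p q = ⋁-elim _ q λ a′ w w≤v r →
      meeting a′ a (∧-elimˡ r) (≤-trans w≤v p) λ eq → subst (λ b → w ≤ h b) eq (∧-elimʳ r)

    glue-intro : ∀ h {v} → (∀ a w → w ≤ v → w ≤ ι̂ a → w ≤ h (rep a)) → v ≤ glue h
    glue-intro h f = antichain-cases λ a w w≤v w≤a → ⋁-intro _ a (∧-greatest w≤a (f a w w≤v w≤a))

    record U-glue (h : ∣A∣ → 𝔹) : Set ℓ where
      constructor glued
      field unglue : U.member (glue h)

    open U-glue public

    U-glue-map : ∀ {h k} → (∀ a {v} → v ≤ ι̂ a → v ≤ h a → v ≤ k a) → U-glue h → U-glue k
    U-glue-map {h} {k} f p = glued (U.upward (glue-intro k λ a w w≤v w≤a →
      f (rep a) (ι̂-rep a w≤a) (glue-elim h a w≤a w≤v)) (unglue p))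

    -- "For almost all a" modulo U; `truth` admits statements of any universe level.
    record Uae {l} (φ : ∣A∣ → Set l) : Set ℓ where
      constructor almost
      field agree : U.member (glue (truth ∘ φ))

    open Uae public

    Uae-zip : ∀ {l m n} {φ : ∣A∣ → Set l} {ψ : ∣A∣ → Set m} {χ : ∣A∣ → Set n} →
              (∀ a → φ a → ψ a → χ a) → Uae φ → Uae ψ → Uae χ
    Uae-zip {φ = φ} {ψ} {χ} f p q = almost (U.upward (glue-intro (truth ∘ χ) λ a w w≤ w≤a →
      truth-elim (glue-elim (truth ∘ φ) a w≤a (∧-elimˡ w≤)) λ x →
      truth-elim (glue-elim (truth ∘ ψ) a w≤a (∧-elimʳ w≤)) λ y →
      truth-intro (f (rep a) x y)) (U.meet (agree p) (agree q)))

    Uae-map : ∀ {l m} {φ : ∣A∣ → Set l} {ψ : ∣A∣ → Set m} → (∀ a → φ a → ψ a) → Uae φ → Uae ψ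
    Uae-map f p = Uae-zip (λ a x _ → f a x) p p

    Uae-all : ∀ {l} {φ : ∣A∣ → Set l} → (∀ a → φ a) → Uae φ
    Uae-all {φ = φ} f = almost
      (U.upward (glue-intro (truth ∘ φ) λ a w _ _ → truth-intro (f (rep a))) U.top)

    Uae-¬ : ∀ {l} {φ : ∣A∣ → Set l} → ¬ Uae φ → Uae (λ a → ¬ φ a)
    Uae-¬ {φ = φ} ¬p = almost (U.upward
      (glue-intro (λ a → truth (¬ φ a)) λ a w w≤ w≤a → by-contradiction λ w≰ →
        w≰ (∁-elim w≤ (⋁-intro _ a (∧-greatest w≤a
          (truth-intro (by-contradiction λ ¬x → w≰ (truth-intro ¬x)))))))
      (U-∁ (¬p ∘ almost)))

    Uae-contradiction : ∀ {l m} {φ : ∣A∣ → Set l} {Whatever : Set m} →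
                        Uae φ → (∀ a → ¬ φ a) → Whatever
    Uae-contradiction p ¬φ = contradiction (U.upward
      (⋁-elim _ ≤-refl λ a w _ w≤ → truth-elim (∧-elimʳ w≤) λ x → contradiction x (¬φ (rep a)))
      (agree p)) U.proper

    -- Excluded middle for the Σ-type itself supplies the witnesses, and y₀ fills the null set
    -- without one. The function g need not respect the equality of A, which `glue` and `fn`
    -- accommodate by representatives.
    Uae-choice : ∀ {l m} {Y : Set l} {φ : ∣A∣ → Y → Set m} → Y →
                 Uae (λ a → ∃ (φ a)) → ∃[ g ] Uae (λ a → φ a (g a))
    Uae-choice {Y = Y} {φ} y₀ p = g , Uae-map good p
      where
      g : ∣A∣ → Y
      g a with em {P = ∃ (φ a)}
      ... | yes (y , _) = y
      ... | no _        = y₀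
      good : ∀ a → ∃ (φ a) → φ a (g a)
      good a ex with em {P = ∃ (φ a)}
      ... | yes (_ , x) = x
      ... | no none     = contradiction ex none

    rep-idem : ∀ a → rep (rep a) ≡ rep a
    rep-idem a = canonical-≡ ac (Sub (elements A)) {rep a} {a} (rep-≈ a)

    Uae-rep : ∀ {l} {φ : ∣A∣ → Set l} → Uae φ ⇔ Uae (φ ∘ rep)
    Uae-rep {φ = φ} = mk⇔
      (λ p → almost (U.upward (glue-intro (truth ∘ φ ∘ rep) λ a w w≤ w≤a →
        subst (λ b → w ≤ truth (φ b)) (sym (rep-idem a)) (glue-elim (truth ∘ φ) a w≤a w≤)) (agree p)))
      (λ p → almost (U.upward (glue-intro (truth ∘ φ) λ a w w≤ w≤a →
        subst (λ b → w ≤ truth (φ b)) (rep-idem a) (glue-elim (truth ∘ φ ∘ rep) a w≤a w≤)) (agree p)))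

    Uae⇒glue : ∀ {l} {φ : ∣A∣ → Set l} {h} → (∀ a {v} → v ≤ ι̂ a → φ a → v ≤ h a) → Uae φ → U-glue h
    Uae⇒glue {φ = φ} f p =
      U-glue-map (λ a v≤a v≤ → truth-elim {φ = φ a} v≤ (f a v≤a)) (glued (agree p))

    glue⇒Uae : ∀ {l} {φ : ∣A∣ → Set l} {h} → (∀ a {v} → ¬ φ a → v ≤ ι̂ a → v ≤ h a → v ≤ 𝟎) →
               U-glue h → Uae φ
    glue⇒Uae f p = almost (unglue (U-glue-map (λ a {v} p q → by-contradiction λ v≰ →
      v≰ (≤-trans (f a (v≰ ∘ truth-intro) p q) (minimum _))) p))

    mixᴬ : (∣A∣ → Name) → Name
    mixᴬ f = mix ι̂ (f ∘ rep)

    mixᴬ-≐ : ∀ f a {v} → v ≤ ι̂ a → v ⊩ mixᴬ f ≐̇ f (rep a)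
    mixᴬ-≐ f = mix-≐ ι̂ (f ∘ rep) λ a a′ p q → forced (meeting a a′ p q λ eq →
      subst (λ b → _ ≤ ⟦ f (rep a) ≐ f b ⟧) eq (force (name-refl (f (rep a)))))

    mixᴬ-∈-intro : ∀ f g {v} → v ≤ glue (λ a → ⟦ f a ∈ g a ⟧) → v ⊩ mixᴬ f ∈̇ mixᴬ g
    mixᴬ-∈-intro f g p = forced (antichain-cases λ a w w≤v w≤a → force
      (∈-replaceˡ (name-sym (mixᴬ-≐ f a w≤a)) (∈-replaceʳ (name-sym (mixᴬ-≐ g a w≤a))
        (forced (glue-elim (λ a → ⟦ f a ∈ g a ⟧) a w≤a (≤-trans w≤v p))))))

    mixᴬ-∈-elim : ∀ f g {v} → v ⊩ mixᴬ f ∈̇ mixᴬ g → v ≤ glue (λ a → ⟦ f a ∈ g a ⟧)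
    mixᴬ-∈-elim f g p = glue-intro (λ a → ⟦ f a ∈ g a ⟧) λ a w w≤v w≤a →
      force (∈-replaceˡ (mixᴬ-≐ f a w≤a) (∈-replaceʳ (mixᴬ-≐ g a w≤a) (weaken w≤v p)))

    mixᴬ-const : ∀ σ {v} → v ⊩ mixᴬ (λ _ → σ) ≐̇ σ
    mixᴬ-const σ = forced (antichain-cases λ a w _ w≤a → force (mixᴬ-≐ (λ _ → σ) a w≤a))

    ⊨∈-mixᴬ : ∀ f g → (⊨ mixᴬ f ∈̇ mixᴬ g) ⇔ U-glue (λ a → ⟦ f a ∈ g a ⟧)
    ⊨∈-mixᴬ f g = mk⇔
      (λ p → glued (U.upward (mixᴬ-∈-elim f g (forced ≤-refl)) (holds p)))
      (λ p → ⊨-intro (unglue p) (mixᴬ-∈-intro f g))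

    fn : (∣A∣ → 𝕍 ℓ) → elements A →𝕍
    fn v = record
      { to   = v ∘ rep
      ; cong = λ {a} {a′} a≈a′ → subst (λ b → v (rep a) ≐ v b)
          (canonical-≡ ac (Sub (elements A)) {a} {a′} a≈a′) (≐-refl (v (rep a)))
      }

    infix 4 _Eᴬ_

    _Eᴬ_ : Rel (elements A →𝕍) ℓ
    _Eᴬ_ = _Eₐ_ A

    ⟨$⟩-rep : ∀ (f : elements A →𝕍) a → f ⟨$⟩ rep a ≐ f ⟨$⟩ a
    ⟨$⟩-rep f a = Func.cong f (rep-≈ a)

    Eᴬ⇔Uae : ∀ f g → f Eᴬ g ⇔ Uae (λ a → f ⟨$⟩ a ∈ g ⟨$⟩ a)
    Eᴬ⇔Uae f g = mk⇔
      (λ p → almost (U.upward (⋁-elim _ ≤-refl λ (a , fa∈ga) w _ w≤a →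
        ⋁-intro _ a (∧-greatest w≤a (truth-intro
          (∈-respˡ (g ⟨$⟩ rep a) (≐-sym _ _ (⟨$⟩-rep f a))
            (∈-respʳ (g ⟨$⟩ a) (g ⟨$⟩ rep a) (≐-sym _ _ (⟨$⟩-rep g a)) fa∈ga))))) p))
      (λ p → U.upward (⋁-elim _ ≤-refl λ a w _ w≤ → truth-elim (∧-elimʳ w≤) λ fa∈ga →
        ⋁-intro _ (rep a , fa∈ga) (ι̂-rep a (∧-elimˡ w≤))) (agree p))

    fn-Eᴬ : ∀ v f → fn v Eᴬ f ⇔ Uae (λ a → v a ∈ f ⟨$⟩ a)
    fn-Eᴬ v f = mk⇔
      (λ p → from Uae-rep (Uae-map (λ a → ∈-respʳ _ _ (≐-sym _ _ (⟨$⟩-rep f a))) (to (Eᴬ⇔Uae (fn v) f) p)))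
      (λ p → from (Eᴬ⇔Uae (fn v) f) (Uae-map (λ a → ∈-respʳ _ _ (⟨$⟩-rep f a)) (to Uae-rep p)))

    Eᴬ-fn : ∀ f v → f Eᴬ fn v ⇔ Uae (λ a → f ⟨$⟩ a ∈ v a)
    Eᴬ-fn f v = mk⇔
      (λ p → from Uae-rep (Uae-map (λ a → ∈-respˡ (v (rep a)) (≐-sym _ _ (⟨$⟩-rep f a)))
        (to (Eᴬ⇔Uae f (fn v)) p)))
      (λ p → from (Eᴬ⇔Uae f (fn v)) (Uae-map (λ a → ∈-respˡ (v (rep a)) (⟨$⟩-rep f a)) (to Uae-rep p)))

    infix 4 _≋_

    record _≋_ (f g : elements A →𝕍) : Set ℓ where
      constructor almost-equal
      field agree-≐ : Uae λ a → f ⟨$⟩ a ≐ g ⟨$⟩ a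

    open _≋_ public

    ≋-sym : ∀ {f g} → f ≋ g → g ≋ f
    ≋-sym p = almost-equal (Uae-map (λ a → ≐-sym _ _) (agree-≐ p))

    Eᴬ-respˡ : ∀ {f f′ g} → f ≋ f′ → f Eᴬ g → f′ Eᴬ g
    Eᴬ-respˡ {f} {f′} {g} f≋f′ fEg = from (Eᴬ⇔Uae f′ g)
      (Uae-zip (λ a → ∈-respˡ (g ⟨$⟩ a)) (agree-≐ f≋f′) (to (Eᴬ⇔Uae f g) fEg))

    Eᴬ-respʳ : ∀ {f g g′} → g ≋ g′ → f Eᴬ g → f Eᴬ g′
    Eᴬ-respʳ {f} {g} {g′} g≋g′ fEg = from (Eᴬ⇔Uae f g′)
      (Uae-zip (λ a → ∈-respʳ _ _) (agree-≐ g≋g′) (to (Eᴬ⇔Uae f g) fEg))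

    ≋-same : ∀ {f g} → f ≋ g → SamePredecessors _Eᴬ_ f g
    ≋-same f≋g z = mk⇔ (Eᴬ-respʳ {z} f≋g) (Eᴬ-respʳ {z} (≋-sym f≋g))

    fn-Eᴬ-fn : ∀ v w → fn v Eᴬ fn w ⇔ Uae (λ a → v a ∈ w a)
    fn-Eᴬ-fn v w = mk⇔ (λ p → from Uae-rep (to (Eᴬ⇔Uae (fn v) (fn w)) p))
                       (λ p → from (Eᴬ⇔Uae (fn v) (fn w)) (to Uae-rep p))

    fn-⟨$⟩ : ∀ f → f ≋ fn (f ⟨$⟩_)
    fn-⟨$⟩ f = almost-equal (Uae-all λ a → ≐-sym _ _ (⟨$⟩-rep f a))

    private
      -- If the inclusion did not hold almost everywhere, it would fail almost everywhere; choosing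
      -- counterexamples would give a member of f that is not a member of g.
      ⊆-almost-everywhere : ∀ f g → (∀ e → e Eᴬ f → e Eᴬ g) →
                            Uae (λ a → ∀ z → z ∈ f ⟨$⟩ a → z ∈ g ⟨$⟩ a)
      ⊆-almost-everywhere f g f⊆g = by-contradiction λ ¬⊆ →
        let (z , p) = Uae-choice ∅ (Uae-map (λ a ¬all → by-contradiction λ none →
                        ¬all λ z z∈f → by-contradiction λ z∉g → none (z , z∈f , z∉g)) (Uae-¬ ¬⊆))
            zEg = f⊆g (fn z) (from (fn-Eᴬ z f) (Uae-map (λ _ → proj₁) p))
        in Uae-contradiction (Uae-zip (λ _ (_ , z∉g) z∈g → contradiction z∈g z∉g) p
             (to (fn-Eᴬ z g) zEg)) λ _ ff → ff

    Eᴬ-extensional : ∀ {f g} → (∀ e → e Eᴬ f → e Eᴬ g) → (∀ e → e Eᴬ g → e Eᴬ f) → f ≋ g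
    Eᴬ-extensional {f} {g} f⊆g g⊆f = almost-equal (Uae-zip (λ a → ≐-ext _ _)
      (⊆-almost-everywhere f g f⊆g) (⊆-almost-everywhere g f g⊆f))

    infix 4 _↦ᴬ_

    record _↦ᴬ_ (f : elements A →𝕍) (m : 𝕍 ℓ) : Set (suc ℓ) where
      constructor collapsesᴬ
      field collapseᴬ : [_]ₐ≐_ A f m

    open _↦ᴬ_ public

    ↦ᴬ-injective : ∀ {f g m} → f ↦ᴬ m → g ↦ᴬ m → f ≋ g
    ↦ᴬ-injective {m = m} p q = collapse-injective _Eᴬ_ _≋_ ≋-sym
      (λ {f} {g} {e} → Eᴬ-respˡ {f} {g} {e}) Eᴬ-extensional m (collapseᴬ p) (collapseᴬ q)

    ↦ᴬ-resp : ∀ {f g m} → f ≋ g → f ↦ᴬ m → g ↦ᴬ m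
    ↦ᴬ-resp {f} {g} {m} f≋g p = collapsesᴬ (collapse-same _Eᴬ_ {f} {g} m (≋-same f≋g) (collapseᴬ p))

    ↦ᴬ-member : ∀ {f m n} → f ↦ᴬ m → n ∈ m → ∃[ d ] (d Eᴬ f) × d ↦ᴬ n
    ↦ᴬ-member {f} {m} {n} p n∈m =
      let (d , dEf , q) = collapse-member _Eᴬ_ {f} m n (collapseᴬ p) n∈m in d , dEf , collapsesᴬ q

    ↦ᴬ-∈ : ∀ {f d m n} → f ↦ᴬ m → d ↦ᴬ n → d Eᴬ f → n ∈ m
    ↦ᴬ-∈ {f} {d} {m} {n} p q dEf = collapse-∈ _Eᴬ_ {f} {d} m n (collapseᴬ p) (collapseᴬ q) dEf

    ↦ᴬ-∈⁻¹ : ∀ {f d m n} → f ↦ᴬ m → d ↦ᴬ n → n ∈ m → d Eᴬ f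
    ↦ᴬ-∈⁻¹ {f} {d} p q n∈m = let (d′ , d′Ef , q′) = ↦ᴬ-member p n∈m in
      Eᴬ-respˡ {d′} {d} {f} (↦ᴬ-injective q′ q) d′Ef

    private
      -- The small cover for `collapse-exists`: a predecessor of g takes values in `g ⟨$⟩ a` almost
      -- everywhere, so indices determine it there. `nothing` covers the remaining points.
      Choices : elements A →𝕍 → Set ℓ
      Choices g = ∀ a → Maybe (Index (g ⟨$⟩ a))

      chosen : ∀ x → Maybe (Index x) → 𝕍 ℓ
      chosen x (just i) = component x i
      chosen x nothing  = ∅

      apply : ∀ g → Choices g → elements A →𝕍
      apply g k = fn λ a → chosen (g ⟨$⟩ a) (k a)

      locate : ∀ x y → Maybe (Index y)
      locate x y with em {a = ℓ} {P = ∃[ i ] x ≐ component y i}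
      ... | yes (i , _) = just i
      ... | no _        = nothing

      locate-≐ : ∀ x y → x ∈ y → chosen y (locate x y) ≐ x
      locate-≐ x y x∈y with em {a = ℓ} {P = ∃[ i ] x ≐ component y i}
      ... | yes (i , e) = ≐-sym _ _ e
      ... | no none     = contradiction (∈-component y x∈y) none

    Eᴬ-covers : ∀ {g f} → f Eᴬ g → ∃[ k ] apply g k Eᴬ g × SamePredecessors _Eᴬ_ (apply g k) f
    Eᴬ-covers {g} {f} fEg = k , Eᴬ-respˡ {f} {apply g k} {g} (≋-sym k≋f) fEg , ≋-same k≋f
      where
      k : Choices g
      k a = locate (f ⟨$⟩ a) (g ⟨$⟩ a)
      k≋f : apply g k ≋ f
      k≋f = almost-equal (from Uae-rep (Uae-map (λ a fa∈ga →
        subst (λ b → chosen (g ⟨$⟩ b) (k b) ≐ f ⟨$⟩ rep a) (sym (rep-idem a))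
          (locate-≐ _ _ fa∈ga)) (to Uae-rep (to (Eᴬ⇔Uae f g) fEg))))

    ↦ᴬ-exists : ∀ {f} → Acc _Eᴬ_ f → ∃ (f ↦ᴬ_)
    ↦ᴬ-exists {f} a =
      let (m , p) = collapse-exists _Eᴬ_ em Choices apply (λ {g} {f} → Eᴬ-covers {g} {f}) a
      in m , collapsesᴬ p

    -- A name for π_{A,∞}([ f ]).
    embed : elements A →𝕍 → Name
    embed f = mixᴬ λ a → check (f ⟨$⟩ a)

    glue-∈ : ∀ {f g : ∣A∣ → 𝕍 ℓ} → U-glue (λ a → ⟦ check (f a) ∈ check (g a) ⟧) ⇔ Uae (λ a → f a ∈ g a)
    glue-∈ {f} {g} = mk⇔ (glue⇒Uae λ a ¬∈ _ p → check-∉ (f a) (g a) ¬∈ (forced p))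
      (Uae⇒glue λ a _ fa∈ga → force (check-∈ (f a) (g a) fa∈ga))

    embed-E : ∀ f g → f Eᴬ g ⇔ (⊨ embed f ∈̇ embed g)
    embed-E f g = mk⇔
      (λ p → from (⊨∈-mixᴬ (λ a → check (f ⟨$⟩ a)) (λ a → check (g ⟨$⟩ a))) (from glue-∈ (to (Eᴬ⇔Uae f g) p)))
      (λ p → from (Eᴬ⇔Uae f g) (to glue-∈ (to (⊨∈-mixᴬ (λ a → check (f ⟨$⟩ a)) (λ a → check (g ⟨$⟩ a))) p)))

    embed-∼ : ∀ {f g} → f ≋ g → embed f ∼ embed g
    embed-∼ {f} {g} f≋g = ⊨-intro (agree (agree-≐ f≋g)) λ v≤ → forced (antichain-cases λ a w w≤v w≤a →
      truth-elim (glue-elim (λ a → truth (f ⟨$⟩ a ≐ g ⟨$⟩ a)) a w≤a (≤-trans w≤v v≤)) λ fa≐ga →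
      force (name-trans (mixᴬ-≐ (λ a → check (f ⟨$⟩ a)) a w≤a)
        (name-trans (check-≐ _ _ fa≐ga) (name-sym (mixᴬ-≐ (λ a → check (g ⟨$⟩ a)) a w≤a)))))

    embed-≐ : ∀ f a {v} → v ≤ ι̂ a → v ⊩ embed f ≐̇ check (f ⟨$⟩ a)
    embed-≐ f a v≤a = name-trans (mixᴬ-≐ (λ a → check (f ⟨$⟩ a)) a v≤a)
      (check-≐ (f ⟨$⟩ rep a) (f ⟨$⟩ a) (⟨$⟩-rep f a))

    -- The ultrapower inherits well-foundedness from the Boolean ultrapower, into which π embeds it.
    embed-acc : ∀ {f} → Acc _E_ (embed f) → Acc _Eᴬ_ f
    embed-acc {f} (acc rs) = acc λ {g} gEf → embed-acc (rs (holds (to (embed-E g f) gEf)))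

  -- Fullness, extensionality modulo U, and names for ground-model sets.

  fullness : {I : Set ℓ} (b : I → 𝔹) (θ : I → Name) →
             ∃[ μ ] ∀ {v} → v ≤ ⋁ b → v ≤ ⋁ λ i → b i ∧ ⟦ μ ≐ θ i ⟧
  fullness {I} b θ = mixᴬ choice , λ {v} p → antichain-cases λ a w w≤v w≤a →
      realised (rep a) w (≤-trans w≤v p) (ι̂-rep a w≤a) (mixᴬ-≐ choice a w≤a)
    where
    -- Deciding conditions are dense, so a maximal antichain consists of them; μ mixes the names
    -- that they pick.
    Decides : Pred P.Carrier ℓ
    Decides p = (∃[ i ] ι p ≤ b i) ⊎ ι p ≤ ∁ (⋁ b)

    dense : ∀ p → ∃[ q ] q P.≤ p × Decides q
    dense p = by-contradiction λ none → none (p , P.refl , inj₂ (∁-intro λ w w≤p w≤⋁ →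
      ⋁-elim b w≤⋁ λ i u u≤w u≤bi → dense-≤ λ q q≤u → contradiction
        (q , ι.cancel (≤-trans q≤u (≤-trans u≤w w≤p)) , inj₁ (i , ≤-trans q≤u u≤bi)) none))

    antichain = antichain-in Decides
      (λ q≤p → λ { (inj₁ (i , p≤)) → inj₁ (i , ≤-trans (ι.mono q≤p) p≤)
                 ; (inj₂ p≤) → inj₂ (≤-trans (ι.mono q≤p) p≤) }) dense

    open OnAntichain (proj₁ antichain)

    choice : ∣A∣ → Name
    choice a with proj₂ antichain (proj₂ a)
    ... | inj₁ (i , _) = θ i
    -- Here the condition lies below the complement of the join, where nothing is claimed about μ,
    -- so any name will do.
    ... | inj₂ _       = check ∅

    realised : ∀ a w {μ} → w ≤ ⋁ b → w ≤ ι̂ a → w ⊩ μ ≐̇ choice a → w ≤ ⋁ λ i → b i ∧ ⟦ μ ≐ θ i ⟧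
    realised a w w≤⋁ w≤a p with proj₂ antichain (proj₂ a)
    ... | inj₁ (i , a≤bi) = ⋁-intro _ i (∧-greatest (≤-trans w≤a a≤bi) (force p))
    ... | inj₂ a≤∁        = ∁-elim (≤-trans w≤a a≤∁) w≤⋁

  private
    -- If U contained this join, fullness would produce one name that is in σ and outside τ modulo
    -- U.
    no-difference : ∀ σ τ → (∀ d → ⊨ d ∈̇ σ → ⊨ d ∈̇ τ) →
                    ¬ U.member (⋁ λ i → wt σ i ∧ ∁ ⟦ elt σ i ∈ τ ⟧)
    no-difference σ τ σ⊆τ p =
      let (μ , realised) = fullness (λ i → wt σ i ∧ ∁ ⟦ elt σ i ∈ τ ⟧) (elt σ)
          p′ = U.upward (realised ≤-refl) p
          μ∈σ = ⊨-intro p′ λ v≤ → forced (⋁-elim _ v≤ λ i w _ q →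
            force (∈-intro σ i (∧-elimˡ (∧-elimˡ q)) (forced {φ = μ ≐̇ elt σ i} (∧-elimʳ q))))
      in U-clash (holds (σ⊆τ μ μ∈σ)) p′ λ v v∈ q → ⋁-elim _ q λ i w w≤v r →
           ∁-elim (∧-elimʳ (∧-elimˡ r))
             (force (∈-replaceˡ (forced {φ = μ ≐̇ elt σ i} (∧-elimʳ r)) (weaken w≤v (forced {φ = μ ∈̇ τ} v∈))))

  ∼-extensional : ∀ {σ τ} → (∀ d → ⊨ d ∈̇ σ → ⊨ d ∈̇ τ) → (∀ d → ⊨ d ∈̇ τ → ⊨ d ∈̇ σ) → σ ∼ τ
  ∼-extensional {σ} {τ} σ⊆τ τ⊆σ =
    ⊨-intro (U.meet (U-∁ (no-difference σ τ σ⊆τ)) (U-∁ (no-difference τ σ τ⊆σ))) λ v≤ →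
      ≐-intro σ τ (λ i w w≤v → included σ τ i (∧-elimˡ (≤-trans w≤v v≤)))
                  (λ j w w≤v → included τ σ j (∧-elimʳ (≤-trans w≤v v≤)))
    where
    included : ∀ σ τ (i : Dom σ) {w} → w ≤ ∁ (⋁ λ i → wt σ i ∧ ∁ ⟦ elt σ i ∈ τ ⟧) →
               w ≤ wt σ i → w ⊩ elt σ i ∈̇ τ
    included σ τ i w≤∁ w≤ = forced (by-cases ⟦ elt σ i ∈ τ ⟧ (λ _ _ p → p) λ u u≤w u≤∁ →
      ∁-elim (≤-trans u≤w w≤∁) (⋁-intro _ i (∧-greatest (≤-trans u≤w w≤) u≤∁)))

  ↦-injective : ∀ {σ τ x} → σ ↦ x → τ ↦ x → σ ∼ τ
  ↦-injective {x = x} p q = collapse-injective _E_ _∼_ ∼-sym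
    (λ {σ} {τ} {d} σ∼τ dEσ → holds (⊨∈-respˡ σ∼τ (valid {σ ∈̇ d} dEσ)))
    (λ {σ} {τ} f g → ∼-extensional
      (λ d p → valid (f d (holds p))) (λ d p → valid (g d (holds p))))
    x (collapse p) (collapse q)

  ↦-exists : ∀ {σ} → Acc _E_ σ → ∃ (σ ↦_)
  ↦-exists a =
    let (x , p) = collapse-exists _E_ em (λ τ → Dom τ → 𝔹) select (λ {τ} {d} → covers {τ} {d}) a
    in x , collapses p
    where
    covers : ∀ {τ d} → d E τ → ∃[ u ] select τ u E τ × SamePredecessors _E_ (select τ u) d
    covers {τ} {d} dEτ = let select∼d = ⊨-map select-≐ (valid {d ∈̇ τ} dEτ) in
      member-weights d τ , holds (⊨∈-respˡ (∼-sym select∼d) (valid {d ∈̇ τ} dEτ)) , ∼-same select∼d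

  ↦-member : ∀ {σ x y} → σ ↦ x → y ∈ x → ∃[ d ] (⊨ d ∈̇ σ) × d ↦ y
  ↦-member {x = x} {y} p y∈x = let (d , dEσ , q) = collapse-member _E_ x y (collapse p) y∈x in
    d , valid dEσ , collapses q

  ↦-∈ : ∀ {σ d x y} → σ ↦ x → d ↦ y → ⊨ d ∈̇ σ → y ∈ x
  ↦-∈ {x = x} {y} p q r = collapse-∈ _E_ x y (collapse p) (collapse q) (holds r)

  ↦-∈⁻¹ : ∀ {σ d x y} → σ ↦ x → d ↦ y → y ∈ x → ⊨ d ∈̇ σ
  ↦-∈⁻¹ p q y∈x = let (d′ , r , q′) = ↦-member p y∈x in ⊨∈-respˡ (↦-injective q′ q) r

  -- The join over all sets y becomes small when indexed by the elements of 𝔹 that occur as its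
  -- terms.
  V̌-value : Name → 𝔹
  V̌-value σ = ⋁ {I = Σ[ b ∈ 𝔹 ] ∥_∥ {ℓ = ℓ} (∃[ y ] b ≈ ⟦ σ ≐ check y ⟧)} proj₁

  V̌-value-intro : ∀ {σ v} y → v ⊩ σ ≐̇ check y → v ≤ V̌-value σ
  V̌-value-intro {σ} y p = ⋁-intro proj₁ (⟦ σ ≐ check y ⟧ , ∣ y , Eq.refl ∣) (force p)

  V̌-value-elim : ∀ {σ v c} → v ≤ V̌-value σ →
                 (∀ y w → w ≤ v → w ⊩ σ ≐̇ check y → w ≤ c) → v ≤ c
  V̌-value-elim p f = ⋁-elim proj₁ p λ (b , q) w w≤v w≤b →
    let (y , b≈) = unbox q in f y w w≤v (forced (≤-trans w≤b (reflexive b≈)))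

  InV̌-intro : ∀ σ → U.member (V̌-value σ) → InV̌ σ
  InV̌-intro σ p = V̌-value σ ,
    ((λ y → V̌-value-intro {σ} y (forced ≤-refl)) ,
     (λ u upper → V̌-value-elim {σ} ≤-refl λ y w _ q → ≤-trans (force q) (upper y))) , p

  InV̌-elim : ∀ σ → InV̌ σ → U.member (V̌-value σ)
  InV̌-elim σ (b , (_ , least) , b∈U) =
    U.upward (least (V̌-value σ) λ y → V̌-value-intro {σ} y (forced ≤-refl)) b∈U

  InV̌-resp : ∀ {σ τ} → σ ∼ τ → InV̌ σ → InV̌ τ
  InV̌-resp {σ} {τ} σ∼τ inV̌ = InV̌-intro τ (U.upward
    (V̌-value-elim {σ} (∧-elimʳ ≤-refl) λ y w w≤ p → V̌-value-intro {τ} y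
      (name-trans (name-sym (forced (∧-elimˡ w≤))) p))
    (U.meet (holds σ∼τ) (InV̌-elim σ inV̌)))

  InV̌-∈ : ∀ {σ d} → InV̌ σ → ⊨ d ∈̇ σ → InV̌ d
  InV̌-∈ {σ} {d} inV̌ d∈σ = InV̌-intro d (U.upward
    (V̌-value-elim {σ} (∧-elimʳ ≤-refl) λ y w w≤ p →
      ∈-check-elim y (∈-replaceʳ p (forced {φ = d ∈̇ σ} (∧-elimˡ w≤))) λ i u _ q →
        V̌-value-intro {d} (component y i) q)
    (U.meet (holds d∈σ) (InV̌-elim σ inV̌)))

  InV̌-check : ∀ x → InV̌ (check x)
  InV̌-check x = InV̌-intro (check x) (U.upward (V̌-value-intro {check x} x (name-refl (check x))) U.top)

  InV̌-embed : ∀ A f → InV̌ (OnAntichain.embed A f)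
  InV̌-embed A f = InV̌-intro (embed f) (U.upward (antichain-cases λ a w _ w≤a →
      V̌-value-intro {embed f} (f ⟨$⟩ rep a) (mixᴬ-≐ (λ a → check (f ⟨$⟩ a)) a w≤a)) U.top)
    where open OnAntichain A

-- The factor map π and representations in terms of names.

module Representations {ℓ : Level} (em : ∀ {a} → ExcludedMiddle a) (ac : AxiomOfChoice ℓ)
                       (P : Poset ℓ ℓ ℓ) (C : Completion P)
                       (U : Ultrafilter (Completion.algebra C))
                       (wf : WellFounded (BooleanUltrapower._Eᵛ_ P C U)) where

  open Classical em
  open BooleanUltrapower P C U hiding (j_≐_)
  open Completion C
  open CompleteBooleanAlgebra algebra
    using (_≤_; ∁_)
    renaming (Carrier to 𝔹; refl to ≤-refl; trans to ≤-trans)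
  open Internal algebra
  open Names em P C U
  open Ultrapowers em ac P C U
  open MaximalAntichain using (elements)
  open Equivalence using (to; from)
  private
    module U = Ultrafilter U
    module ι = IsOrderMonomorphism ι-embedding

  -- E-predecessors of a name in `InV̌` are again in `InV̌`, so well-foundedness of the Boolean
  -- ultrapower gives accessibility for E itself.
  V̌-acc : ∀ σ → InV̌ σ → Acc _E_ σ
  V̌-acc σ inV̌ = go (wf (_ , inV̌))
    where
    go : ∀ {s} → Acc _Eᵛ_ s → Acc _E_ (proj₁ s)
    go {s} (acc rs) = acc λ {d} dEσ → go (rs {d , InV̌-∈ (proj₂ s) (valid {d ∈̇ proj₁ s} dEσ)} dEσ)

  V̌-collapse : ∀ σ → InV̌ σ → ∃ (σ ↦_)
  V̌-collapse σ inV̌ = ↦-exists (V̌-acc σ inV̌)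

  private
    ∈-upair-cases : ∀ {σ τ d} → ⊨ d ∈̇ upair σ τ → ¬ (d ∼ σ) → d ∼ τ
    ∈-upair-cases {σ} {τ} {d} p d≁σ = ⊨-intro (U.meet (holds p) (U-∁ (d≁σ ∘ valid))) λ v≤ →
      ∈-upair-elim (forced {φ = d ∈̇ upair σ τ} (∧-elimˡ v≤))
        (λ w w≤v q → forced (∁-elim (≤-trans w≤v (∧-elimʳ v≤)) (force q))) (λ w _ q → q)

  ↦-upair : ∀ {σ τ x y} → σ ↦ x → τ ↦ y → upair σ τ ↦ ｛ x , y ｝
  ↦-upair {σ} {τ} {x} {y} p q = collapses (into , λ
    { (lift true)  → σ , holds σ∈ , collapse p
    ; (lift false) → τ , holds τ∈ , collapse q })
    where
    σ∈ : ⊨ σ ∈̇ upair σ τ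
    σ∈ = ⊨-intro U.top λ _ → ∈-upairˡ (name-refl σ)
    τ∈ : ⊨ τ ∈̇ upair σ τ
    τ∈ = ⊨-intro U.top λ _ → ∈-upairʳ (name-refl τ)
    into : ∀ d → d E upair σ τ → ∃[ i ] Collapse _E_ d (component ｛ x , y ｝ i)
    into d dE with em {P = d ∼ σ}
    ... | yes d∼σ = lift true , collapse (↦-resp (∼-sym d∼σ) p)
    ... | no d≁σ  = lift false , collapse (↦-resp (∼-sym (∈-upair-cases (valid dE) d≁σ)) q)

  ↦-pair : ∀ {σ τ x y} → σ ↦ x → τ ↦ y → pair σ τ ↦ ⟪ x , y ⟫
  ↦-pair p q = ↦-upair (↦-upair p p) (↦-upair p q)

  ↦-pairʳ : ∀ {μ x y} → μ ↦ ⟪ x , y ⟫ → ∃[ τ ] τ ↦ y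
  ↦-pairʳ {μ} {x} {y} p =
    let (ν , _ , q) = ↦-member {y = ｛ x , y ｝} p (lift false , ≐-refl ｛ x , y ｝)
        (τ , _ , r) = ↦-member {y = y} q (lift false , ≐-refl y)
    in τ , r

  module _ (A : MaximalAntichain P) {G : 𝕍 ℓ} (Ġ↦G : Ġ ↦ G) where
    open OnAntichain A

    private
      codes : elements A →𝕍
      codes = record { to = λ a → ⌜ ι̂ a ⌝ ; cong = λ a≈a′ → Injection.cong code (ι.cong a≈a′) }

      -- The name of the unique element of j(A) ∩ G.
      β : Name
      β = embed codes

      β-≐ : ∀ a {v} → v ≤ ι̂ a → v ⊩ β ≐̇ check ⌜ ι̂ (rep a) ⌝
      β-≐ a = mixᴬ-≐ (λ a → check (codes ⟨$⟩ a)) a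

      along-A : ∀ {φ} → (∀ a {v} → v ≤ ι̂ a → v ⊩ φ) → ∀ {v} → v ⊩ φ
      along-A f = forced (antichain-cases λ a w _ w≤a → force (f a w≤a))

      β-∈-asSet : ∀ {v} → v ⊩ β ∈̇ check (asSet A)
      β-∈-asSet = along-A λ a v≤a → ∈-replaceˡ (name-sym (β-≐ a v≤a))
        (check-∈ ⌜ ι̂ (rep a) ⌝ (asSet A) (rep a , ≐-refl ⌜ ι̂ (rep a) ⌝))

      β-∈-Ġ : ∀ {v} → v ⊩ β ∈̇ Ġ
      β-∈-Ġ = along-A λ a v≤a → ∈-replaceˡ (name-sym (β-≐ a v≤a))
        (∈Ġ-intro (ι̂ (rep a)) (ι̂-rep a v≤a))

      β-unique : ∀ {γ} → ⊨ γ ∈̇ check (asSet A) → ⊨ γ ∈̇ Ġ → γ ∼ β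
      β-unique {γ} = ⊨-zip λ p q → forced (∈-check-elim (asSet A) p λ a w w≤v γ≐a →
        force (name-trans γ≐a (name-sym
          (embed-≐ codes a (∈Ġ-elim (ι̂ a) (∈-replaceˡ γ≐a (weaken w≤v q)))))))

      Isb⇒β↦ : ∀ {b} → Isbₐ A b → β ↦ b
      Isb⇒β↦ (jA , G′ , [A] , [Ġ]′ , b∈jA , b∈G′ , _) =
        let (γ , γ∈A , γ↦b) = ↦-member (collapses [A]) b∈jA
        in ↦-resp (β-unique γ∈A (↦-∈⁻¹ (collapses [Ġ]′) γ↦b b∈G′)) γ↦b

      β↦⇒Isb : ∀ {b} → β ↦ b → Isbₐ A b
      β↦⇒Isb β↦b = let (jA , A↦jA) = V̌-collapse (check (asSet A)) (InV̌-check (asSet A)) in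
        jA , G , collapse A↦jA , collapse Ġ↦G ,
        ↦-∈ A↦jA β↦b (⊨-intro U.top λ _ → β-∈-asSet) ,
        ↦-∈ Ġ↦G β↦b (⊨-intro U.top λ _ → β-∈-Ġ) ,
        λ c c∈jA c∈G →
          let (γ , γ∈A , γ↦c) = ↦-member A↦jA c∈jA
          in ↦-unique (↦-resp (β-unique γ∈A (↦-∈⁻¹ Ġ↦G γ↦c c∈G)) γ↦c) β↦b

    embed-total : ∀ f → ∃ (embed f ↦_)
    embed-total f = V̌-collapse (embed f) (InV̌-embed A f)

    ↦ᴬ-total : ∀ f → ∃ (f ↦ᴬ_)
    ↦ᴬ-total f = ↦ᴬ-exists (embed-acc {f} (V̌-acc (embed f) (InV̌-embed A f)))

    -- Below `ι̂ a` the pair of β and `embed f` is the point of the graph of f at a, so j(f) sends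
    -- the value of β to that of `embed f`. With `π-elim`, this reduces π to `embed`.
    π-intro : ∀ {f m z} → f ↦ᴬ m → embed f ↦ z → π_≐_ A m z
    π-intro {f} {m} {z} f↦m embed↦z =
      let (b , β↦b) = embed-total codes
          (jf , graph↦jf) = V̌-collapse (check (graph A f)) (InV̌-check (graph A f))
      in f , collapseᴬ f↦m , jf , b , collapse graph↦jf , β↦⇒Isb β↦b ,
         ↦-∈ graph↦jf (↦-pair β↦b embed↦z) (⊨-intro U.top λ _ → in-graph)
      where
      in-graph : ∀ {v} → v ⊩ pair β (embed f) ∈̇ check (graph A f)
      in-graph = along-A λ a v≤a →
        let point = ⟪ ⌜ ι̂ a ⌝ , f ⟨$⟩ a ⟫ in
        ∈-replaceˡ (name-trans (check-pair ⌜ ι̂ a ⌝ (f ⟨$⟩ a))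
            (name-sym (pair-cong (embed-≐ codes a v≤a) (embed-≐ f a v≤a))))
          (check-∈ point (graph A f) (a , ≐-refl point))

    π-elim : ∀ {m z} → π_≐_ A m z → ∃[ f ] f ↦ᴬ m × embed f ↦ z
    π-elim {m} {z} (f , [f] , jf , b , [graph] , isb , bz∈jf) =
      let (μ , μ∈graph , μ↦) = ↦-member {y = ⟪ b , z ⟫} (collapses [graph]) bz∈jf
          (ζ , ζ↦z) = ↦-pairʳ {x = b} μ↦
          μ∼ = ↦-injective μ↦ (↦-pair (Isb⇒β↦ isb) ζ↦z)
      in f , collapsesᴬ [f] , ↦-resp (⊨-map second (⊨∈-respˡ μ∼ μ∈graph)) ζ↦z
      where
      second : ∀ {ζ v} → v ⊩ pair β ζ ∈̇ check (graph A f) → v ⊩ ζ ≐̇ embed f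
      second {ζ} p = forced (∈-check-elim (graph A f) p λ a w w≤v q →
        let e : w ⊩ pair β ζ ≐̇ pair (check ⌜ ι̂ a ⌝) (check (f ⟨$⟩ a))
            e = name-trans q (check-pair ⌜ ι̂ a ⌝ (f ⟨$⟩ a))
            β≐a = pair-injˡ {β} {ζ} {check ⌜ ι̂ a ⌝} {check (f ⟨$⟩ a)} e
            ζ≐fa = pair-injʳ {β} {ζ} {check ⌜ ι̂ a ⌝} {check (f ⟨$⟩ a)} e
            w≤a = ∈Ġ-elim (ι̂ a) (∈-replaceˡ β≐a β-∈-Ġ)
        in force (name-trans ζ≐fa (name-sym (embed-≐ f a w≤a))))

    -- With `represents-elim`, this replaces the collapse of the ultrapower and the preimage under π
    -- by a condition on functions d and the values of `embed d`.
    represents-intro : ∀ f x → (∀ d {z} → embed d ↦ z → (d Eᴬ f) ⇔ (z ∈ x)) → Represents A f x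
    represents-intro f x char = go (↦ᴬ-total f)
      where
      go : ∃ (f ↦ᴬ_) → Represents A f x
      go (y , f↦y) = y , collapseᴬ f↦y , λ m → mk⇔ to-preimage from-preimage
        where
        to-preimage : ∀ {m} → m ∈ y → _∈preimage_ A m x
        to-preimage m∈y =
          let (d , dEf , d↦m) = ↦ᴬ-member f↦y m∈y
              (z , embed↦z) = embed-total d
          in z , π-intro d↦m embed↦z , to (char d embed↦z) dEf
        from-preimage : ∀ {m} → _∈preimage_ A m x → m ∈ y
        from-preimage (z , πm≐z , z∈x) =
          let (d , d↦m , embed↦z) = π-elim πm≐z
          in ↦ᴬ-∈ f↦y d↦m (from (char d embed↦z) z∈x)

    represents-elim : ∀ f x → Represents A f x → ∀ d {z} → embed d ↦ z → (d Eᴬ f) ⇔ (z ∈ x)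
    represents-elim f x (y , [f] , char) d {z} embed↦z = go (↦ᴬ-total d)
      where
      go : ∃ (d ↦ᴬ_) → (d Eᴬ f) ⇔ (z ∈ x)
      go (m , d↦m) = mk⇔ to-member from-member
        where
        to-member : d Eᴬ f → z ∈ x
        to-member dEf =
          let (z′ , πm≐z′ , z′∈x) = to (char m) (↦ᴬ-∈ (collapsesᴬ [f]) d↦m dEf)
              (d′ , d′↦m , embed↦z′) = π-elim πm≐z′
              d∼d′ = embed-∼ (↦ᴬ-injective d↦m d′↦m)
          in ∈-respˡ x (↦-unique (↦-resp (∼-sym d∼d′) embed↦z′) embed↦z) z′∈x
        from-member : z ∈ x → d Eᴬ f
        from-member z∈x = ↦ᴬ-∈⁻¹ (collapsesᴬ [f]) d↦m (from (char m) (z , π-intro d↦m embed↦z , z∈x))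

-- Computing the Boolean-valued model inside each ultrapower.

module UniformGeneric {ℓ : Level} (em : ∀ {a} → ExcludedMiddle a) (ac : AxiomOfChoice ℓ)
                      (P : Poset ℓ ℓ ℓ) (C : Completion P)
                      (U : Ultrafilter (Completion.algebra C))
                      (wf : WellFounded (BooleanUltrapower._Eᵛ_ P C U))
                      (G : 𝕍 ℓ) ([Ġ] : BooleanUltrapower.[_]≐_ P C U (BooleanUltrapower.Ġ P C U) G)
                      (G⃗ : Poset.Eq.setoid P ⟶ₛ 𝕍-setoid {ℓ})
                      (representsG : ∀ A → BooleanUltrapower.Represents P C U A
                        (BooleanUltrapower._↾_ P C U G⃗ (MaximalAntichain.elements A)) G)
                      where

  open Classical em
  open BooleanUltrapower P C U hiding (j_≐_)
  open Completion C
  open CompleteBooleanAlgebra algebra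
    using (𝟏; 𝟎; _≈_; _≤_; _∧_; ∁_; ⋁; ∧-greatest; maximum; minimum; reflexive; antisym; module Eq)
    renaming (Carrier to 𝔹; refl to ≤-refl; trans to ≤-trans)
  open Internal algebra
  open Names em P C U
  open Ultrapowers em ac P C U
  open Representations em ac P C U wf
  open MaximalAntichain using (elements)
  open Equivalence using (to; from)
  private
    module P = Poset P
    module U = Ultrafilter U
    module ι = IsOrderMonomorphism ι-embedding

    Ġ↦G : Ġ ↦ G
    Ġ↦G = collapses [Ġ]

  module _ (A : MaximalAntichain P) where
    open OnAntichain A

    -- The uniform representation of G in Boolean terms.
    glue⇔G⃗ : ∀ h → U-glue h ⇔ Uae (λ a → ⌜ h a ⌝ ∈ G⃗ ⟨$⟩ proj₁ a)
    glue⇔G⃗ h = go (embed-total A Ġ↦G d)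
      where
      d = fn λ a → ⌜ h a ⌝
      go : ∃ (embed d ↦_) → U-glue h ⇔ Uae (λ a → ⌜ h a ⌝ ∈ G⃗ ⟨$⟩ proj₁ a)
      go (z , embed↦z) = mk⇔
        (λ p → to (fn-Eᴬ _ (G⃗ ↾ elements A)) (from rep-G (↦-∈ Ġ↦G embed↦z
          (⊨-intro (unglue p) λ v≤ → forced (antichain-cases λ a w w≤v w≤a → force
            (∈-replaceˡ (name-sym (embed-≐ d a w≤a))
              (∈Ġ-intro (h (rep a)) (glue-elim h a w≤a (≤-trans w≤v v≤)))))))))
        (λ p → glued (U.upward (glue-intro h λ a w w≤ w≤a →
            ∈Ġ-elim (h (rep a)) (∈-replaceˡ (embed-≐ d a w≤a) (forced {φ = embed d ∈̇ Ġ} w≤)))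
          (holds (↦-∈⁻¹ Ġ↦G embed↦z (to rep-G (from (fn-Eᴬ _ (G⃗ ↾ elements A)) p))))))
        where
        rep-G = represents-elim A Ġ↦G (G⃗ ↾ elements A) G (representsG A) d embed↦z

    -- The fibre at a of the Boolean ultrapower as seen from the ultrapower by A.
    -- Restricting to selected names makes it set-like even when G⃗ a is no filter.
    Local : ∣A∣ → Rel Name (suc ℓ)
    Local a d τ = (∃[ u ] d ≡ select τ u) × ⌜ ⟦ d ∈ τ ⟧ ⌝ ∈ G⃗ ⟨$⟩ proj₁ a

    local-exists : ∀ a {σ} → Acc (Local a) σ → ∃ {A = 𝕍 ℓ} (Collapse (Local a) σ)
    local-exists a = collapse-exists (Local a) em (λ τ → Dom τ → 𝔹) select
      λ { ((u , refl) , p) → u , ((u , refl) , p) , λ _ → mk⇔ (λ q → q) (λ q → q) }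

    local⇒∈ : ∀ f g → Uae (λ a → Local a (f a) (g a)) → ⊨ mixᴬ f ∈̇ mixᴬ g
    local⇒∈ f g p = from (⊨∈-mixᴬ f g) (from (glue⇔G⃗ λ a → ⟦ f a ∈ g a ⟧) (Uae-map (λ _ → proj₂) p))

    -- Selecting from each `f a` with the weights of d gives names whose mixture is d again, so
    -- restricting `Local` to selected names loses no member.
    ∈⇒local : ∀ f {d} → ⊨ d ∈̇ mixᴬ f → ∃[ h ] mixᴬ h ∼ d × Uae (λ a → Local a (h a) (f a))
    ∈⇒local f {d} p = h , h∼d , Uae-map (λ a q → (member-weights d (f a) , refl) , q)
        (to (glue⇔G⃗ λ a → ⟦ h a ∈ f a ⟧) (to (⊨∈-mixᴬ h f) (⊨∈-respˡ (∼-sym h∼d) p)))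
      where
      h : ∣A∣ → Name
      h a = select (f a) (member-weights d (f a))
      h∼d : mixᴬ h ∼ d
      h∼d = ⊨-map (λ q → forced (antichain-cases λ a w w≤v w≤a → force (name-trans (mixᴬ-≐ h a w≤a)
        (select-≐ (∈-replaceʳ (mixᴬ-≐ f a w≤a) (weaken w≤v q)))))) p

    local-pred : ∀ (f h : ∣A∣ → Name) {v : ∣A∣ → 𝕍 ℓ} → Uae (λ a → Collapse (Local a) (f a) (v a)) →
                 Uae (λ a → Local a (h a) (f a)) →
                 ∃[ w ] (fn w Eᴬ fn v) × Uae (λ a → Collapse (Local a) (h a) (w a))
    local-pred f h {v} col loc =
      let (w , p) = Uae-choice {Y = 𝕍 ℓ} {φ = λ a y → y ∈ v a × Collapse (Local a) (h a) y} ∅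
            (Uae-zip (λ a → collapse-pred (Local a) (v a)) col loc)
      in w , from (fn-Eᴬ-fn w v) (Uae-map (λ _ → proj₁) p) , Uae-map (λ _ → proj₂) p

    local-member : ∀ (f : ∣A∣ → Name) {v : ∣A∣ → 𝕍 ℓ} {d} → Uae (λ a → Collapse (Local a) (f a) (v a)) →
                   (d Eᴬ fn v) →
                   ∃[ h ] Uae (λ a → Local a (h a) (f a)) × Uae (λ a → Collapse (Local a) (h a) (d ⟨$⟩ a))
    local-member f {v} {d} col dEv =
      let (h , p) = Uae-choice {Y = Name} {φ = λ a e → Local a e (f a) × Collapse (Local a) e (d ⟨$⟩ a)}
            (check ∅)
            (Uae-zip (λ a → collapse-member (Local a) (v a) (d ⟨$⟩ a)) col (to (Eᴬ-fn d v) dEv))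
      in h , Uae-map (λ _ → proj₁) p , Uae-map (λ _ → proj₂) p

    -- Collapsing commutes with the passage to the ultrapower. Here and in `↦⇒local` the induction
    -- is on m, with members moved between the fibres and the mixed names at each level.
    local⇒↦ : ∀ m (f : ∣A∣ → Name) {v : ∣A∣ → 𝕍 ℓ} → Uae (λ a → Collapse (Local a) (f a) (v a)) →
              fn v ↦ᴬ m → mixᴬ f ↦ m
    local⇒↦ (sup I g) f {v} col v↦@(collapsesᴬ (into , onto)) = collapses
      ( (λ d dEf →
          let (h , h∼d , loc)  = ∈⇒local f (valid {d ∈̇ mixᴬ f} dEf)
              (w , wEv , col′) = local-pred f h col loc
              (i , w↦)         = into (fn w) wEv
          in i , collapse (↦-resp h∼d (local⇒↦ (g i) h col′ (collapsesᴬ w↦))))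
      , (λ i →
          let (d , dEv , d↦)   = onto i
              (h , loc , col′) = local-member f {v} {d} col dEv
          in mixᴬ h , holds (local⇒∈ h f loc) ,
             collapse (local⇒↦ (g i) h col′ (↦ᴬ-resp (fn-⟨$⟩ d) (collapsesᴬ d↦)))) )

    ↦⇒local : ∀ m (f : ∣A∣ → Name) {v : ∣A∣ → 𝕍 ℓ} → Uae (λ a → Collapse (Local a) (f a) (v a)) →
              mixᴬ f ↦ m → fn v ↦ᴬ m
    ↦⇒local (sup I g) f {v} col (collapses (into , onto)) = collapsesᴬ
      ( (λ d dEv →
          let (h , loc , col′) = local-member f {v} {d} col dEv
              (i , h↦)         = into (mixᴬ h) (holds (local⇒∈ h f loc))
          in i , collapseᴬ (↦ᴬ-resp (≋-sym (fn-⟨$⟩ d)) (↦⇒local (g i) h col′ (collapses h↦))))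
      , (λ i →
          let (d , dEf , d↦)   = onto i
              (h , h∼d , loc)  = ∈⇒local f (valid {d ∈̇ mixᴬ f} dEf)
              (w , wEv , col′) = local-pred f h col loc
          in fn w , wEv , collapseᴬ (↦⇒local (g i) h col′ (↦-resp (∼-sym h∼d) (collapses d↦)))) )

    -- If accessibility failed almost everywhere, choosing inaccessible local predecessors would
    -- give a mixture that is an E-predecessor of σ, to which the induction applies.
    local-acc : ∀ {σ} → Acc _E_ σ → ∀ f → σ ∼ mixᴬ f → Uae (λ a → Acc (Local a) (f a))
    local-acc {σ} (acc rs) f σ∼f = by-contradiction λ ¬acc →
      let (h , p) = Uae-choice {Y = Name} {φ = λ a d → Local a d (f a) × ¬ Acc (Local a) d} (check ∅)
            (Uae-map (λ a ¬acc → by-contradiction λ none → ¬acc (acc λ {d} loc →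
              by-contradiction λ ¬acc′ → none (d , loc , ¬acc′))) (Uae-¬ ¬acc))
          h∈σ = ⊨∈-respʳ (∼-sym σ∼f) (local⇒∈ h f (Uae-map (λ _ → proj₁) p))
      in Uae-contradiction (Uae-zip (λ _ a (_ , ¬a) → ¬a a)
           (local-acc (rs (holds h∈σ)) h (∼-intro (name-refl (mixᴬ h)))) p) λ _ ff → ff

    local-collapse : ∀ f {x} → mixᴬ f ↦ x →
                     ∃[ v ] Uae (λ a → Collapse (Local a) (f a) (v a)) × fn v ↦ᴬ x
    local-collapse f {x} f↦x =
      let (v , col) = Uae-choice {Y = 𝕍 ℓ} {φ = λ a → Collapse (Local a) (f a)} ∅
            (Uae-map (λ a → local-exists a)
              (local-acc (collapse-acc _E_ x (collapse f↦x)) f (∼-intro (name-refl (mixᴬ f)))))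
      in v , col , ↦⇒local x f col f↦x

    V^𝔹/U⊆M : ∀ {σ x} → σ ↦ x → M A x
    V^𝔹/U⊆M {σ} σ↦x =
      let (v , _ , v↦x) = local-collapse (λ _ → σ) (↦-resp (∼-sym (∼-intro (mixᴬ-const σ))) σ↦x)
      in fn v , collapseᴬ v↦x

  -- From a name to a continuous representation.

  private
    module ForcedMembers (σ : Name) where

      membership : 𝕍 ℓ → 𝔹
      membership y = ⟦ check y ∈ σ ⟧

      membership-cong : ∀ {y z} → y ≐ z → membership y ≈ membership z
      membership-cong {y} {z} y≐z = antisym (one-way y≐z) (one-way (≐-sym y z y≐z))
        where
        one-way : ∀ {y z} → y ≐ z → membership y ≤ membership z
        one-way {y} {z} y≐z = force (∈-replaceˡ (check-≐ y z y≐z) (forced {φ = check y ∈̇ σ} ≤-refl))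

      -- A value ⟦ y̌ = elt σ i ⟧ ≠ 0 determines y.
      possible : 𝕍 ℓ
      possible = sup (Σ[ i ∈ Dom σ ] Σ[ b ∈ 𝔹 ]
          ∥_∥ {ℓ = ℓ} (∃[ y ] b ≈ ⟦ check y ≐ elt σ i ⟧ × ¬ (b ≤ 𝟎)))
        λ (_ , _ , p) → proj₁ (unbox p)

      possible-intro : ∀ y → ¬ (membership y ≤ 𝟎) → y ∈ possible
      possible-intro y y≰𝟎 = by-contradiction λ y∉ → y≰𝟎 (∈-elim (forced {φ = check y ∈̇ σ} ≤-refl)
        λ i w _ _ p → by-contradiction λ w≰𝟎 → y∉ (index i (λ q → w≰𝟎 (≤-trans (force p) q))))
        where
        index : ∀ i → ¬ (⟦ check y ≐ elt σ i ⟧ ≤ 𝟎) → y ∈ possible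
        index i ≰𝟎 = (i , ⟦ check y ≐ elt σ i ⟧ , p) , by-contradiction λ y≐̸ →
            ≰𝟎 (check-≐̸ y y′ y≐̸ (name-trans {τ = elt σ i} (forced ≤-refl)
              (name-sym {y′ˇ} {elt σ i} (forced (reflexive b≈)))))
          where
          p : ∥_∥ {ℓ = ℓ} (∃[ y′ ] ⟦ check y ≐ elt σ i ⟧ ≈ ⟦ check y′ ≐ elt σ i ⟧ ×
                ¬ (⟦ check y ≐ elt σ i ⟧ ≤ 𝟎))
          p = ∣ y , Eq.refl , ≰𝟎 ∣
          y′ = proj₁ (unbox p)
          y′ˇ = check y′
          b≈ = proj₁ (proj₂ (unbox p))

      -- The forced part makes the representation of σ continuous; where p is
      -- undecided, G⃗ decides, so that it remains uniform.
      In : P.Carrier → 𝕍 ℓ → Set ℓ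
      In p y = ι p ≤ membership y ⊎ (¬ (ι p ≤ ∁ membership y) × ⌜ membership y ⌝ ∈ G⃗ ⟨$⟩ p)

      In-resp : ∀ {p q} → p P.≈ q → ∀ {y z} → y ≐ z → In p y → In q z
      In-resp {p} {q} p≈q {y} {z} y≐z = [ inj₁ ∘ (λ p≤ → ≤-trans q≤p (≤-trans p≤ (reflexive y≈z)))
        , (λ (p≰ , y∈) → inj₂
            ( (λ q≤ → p≰ (≤-trans p≤q (≤-trans q≤ (∁-intro λ w w≤ w≤y →
                ∁-elim w≤ (≤-trans w≤y (reflexive y≈z))))))
            , ∈-respˡ (G⃗ ⟨$⟩ q) (Injection.cong code y≈z)
                (∈-respʳ (G⃗ ⟨$⟩ p) (G⃗ ⟨$⟩ q) (Func.cong G⃗ p≈q) y∈)))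
        ]′
        where
        y≈z = membership-cong y≐z
        q≤p = ι.mono (P.reflexive (P.Eq.sym p≈q))
        p≤q = ι.mono (P.reflexive p≈q)

      In⇒possible : ∀ p y → In p y → y ∈ possible
      In⇒possible p y (inj₁ p≤) = possible-intro y λ y≤𝟎 →
        ι-nonzero p (antisym (≤-trans p≤ y≤𝟎) (minimum _))
      In⇒possible p y (inj₂ (p≰ , _)) = possible-intro y λ y≤𝟎 →
        p≰ (∁-intro λ w _ w≤y → ≤-trans w≤y y≤𝟎)

      section : P.Carrier → 𝕍 ℓ
      section p = separate em possible (In p) (In-resp P.Eq.refl)

      section⇔In : ∀ p y → y ∈ section p ⇔ In p y
      section⇔In p y = mk⇔ (separate-elim em possible (In p) (In-resp P.Eq.refl))
        (λ q → separate-intro em possible (In p) (In-resp P.Eq.refl) (In⇒possible p y q) q)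

      section-cong : ∀ {p q} → p P.≈ q → section p ≐ section q
      section-cong {p} {q} p≈q = ≐-ext (section p) (section q)
        (λ y → from (section⇔In q y) ∘ In-resp p≈q (≐-refl y) ∘ to (section⇔In p y))
        (λ y → from (section⇔In p y) ∘ In-resp (P.Eq.sym p≈q) (≐-refl y) ∘ to (section⇔In q y))

      module _ (B : MaximalAntichain P) where
        open OnAntichain B

        -- Forcing overrides `G⃗` without changing the answer modulo U. If the glued value is
        -- outside U, then `G⃗` almost never accepts, so almost every a in `In` forces membership.
        -- If it is inside U, then `G⃗` almost always accepts, so almost every a not in `In` forces
        -- the complement.
        Uae-In : ∀ (y : ∣A∣ → 𝕍 ℓ) → Uae (λ a → In (proj₁ a) (y a)) ⇔ U-glue (membership ∘ y)
        Uae-In y = mk⇔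
          (λ p → by-contradiction λ ¬glue → ¬glue (Uae⇒glue (λ a v≤a a≤ → ≤-trans v≤a a≤)
            (Uae-zip (λ a → λ { (inj₁ a≤) _ → a≤ ; (inj₂ (_ , y∈)) y∉ → contradiction y∈ y∉ })
              p (Uae-¬ (¬glue ∘ from (glue⇔G⃗ B (membership ∘ y)))))))
          (λ p → by-contradiction λ ¬In →
            let refuted = Uae⇒glue {h = ∁_ ∘ membership ∘ y} (λ a v≤a a≤ → ≤-trans v≤a a≤)
                  (Uae-zip (λ a ¬in y∈ → by-contradiction λ a≰ → ¬in (inj₂ (a≰ , y∈)))
                    (Uae-¬ ¬In) (to (glue⇔G⃗ B (membership ∘ y)) p))
            in U-clash (unglue p) (unglue refuted) λ v v≤ v≤∁ → antichain-cases λ a w w≤v w≤a →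
                 ∁-elim (glue-elim (∁_ ∘ membership ∘ y) a w≤a (≤-trans w≤v v≤∁))
                        (glue-elim (membership ∘ y) a w≤a (≤-trans w≤v v≤)))

        section-represents : ∀ {x} → σ ↦ x → (f : elements B →𝕍) → (∀ a → f ⟨$⟩ a ≡ section (proj₁ a)) →
                             Represents B f x
        section-represents {x} σ↦x f f≡ = represents-intro B Ġ↦G f x λ d {z} embed↦z → mk⇔
          (λ dEf → ↦-∈ σ↦x embed↦z (to (d∈f⇔d∈σ d) dEf))
          (λ z∈x → from (d∈f⇔d∈σ d) (↦-∈⁻¹ σ↦x embed↦z z∈x))
          where
          ∈f⇔In : ∀ y a → y ∈ f ⟨$⟩ a ⇔ In (proj₁ a) y
          ∈f⇔In y a with f ⟨$⟩ a | f≡ a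
          ... | _ | refl = section⇔In (proj₁ a) y

          d∈f⇔d∈σ : ∀ d → d Eᴬ f ⇔ (⊨ embed d ∈̇ σ)
          d∈f⇔d∈σ d = mk⇔
            (λ dEf → ⊨-intro
              (unglue (to (Uae-In (d ⟨$⟩_)) (Uae-map (λ a → to (∈f⇔In (d ⟨$⟩ a) a)) (to (Eᴬ⇔Uae d f) dEf))))
              λ v≤ → forced (antichain-cases λ a w w≤v w≤a → force (∈-replaceˡ
                (name-sym (mixᴬ-≐ (λ a → check (d ⟨$⟩ a)) a w≤a))
                (forced {φ = check (d ⟨$⟩ rep a) ∈̇ σ}
                  (glue-elim (membership ∘ (d ⟨$⟩_)) a w≤a (≤-trans w≤v v≤))))))
            (λ p → from (Eᴬ⇔Uae d f) (Uae-map (λ a → from (∈f⇔In (d ⟨$⟩ a) a)) (from (Uae-In (d ⟨$⟩_))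
              (glued (U.upward (glue-intro (membership ∘ (d ⟨$⟩_)) λ a w w≤ w≤a → force
                (∈-replaceˡ (mixᴬ-≐ (λ a → check (d ⟨$⟩ a)) a w≤a)
                  (forced {φ = embed d ∈̇ σ} w≤))) (holds p))))))

      -- Either p forces y out of σ, and no section below p contains y, or some q below p forces y
      -- into σ, and every section below q does.
      section-continuous : ∀ y p → ∃[ q ] q P.≤ p ×
        (∀ r₁ r₂ → r₁ P.≤ q → r₂ P.≤ q → y ∈ section r₁ → y ∈ section r₂)
      section-continuous y p with em {P = ι p ≤ ∁ membership y}
      ... | yes p≤ = p , P.refl , λ r₁ r₂ r₁≤p _ y∈ →
          contradiction (to (section⇔In r₁ y) y∈) [ (λ r₁≤ → ι-nonzero r₁
            (antisym (∁-elim (≤-trans (ι.mono r₁≤p) p≤) r₁≤) (minimum _)))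
          , (λ (r₁≰ , _) → r₁≰ (≤-trans (ι.mono r₁≤p) p≤)) ]′
      ... | no p≰ =
        let (q , q≤) = ι-dense (ι p ∧ membership y) λ ≈𝟎 → p≰ (∁-intro λ w w≤p w≤y →
              ≤-trans (∧-greatest w≤p w≤y) (reflexive ≈𝟎))
        in q , ι.cancel (∧-elimˡ q≤) , λ r₁ r₂ _ r₂≤q _ →
             from (section⇔In r₂ y) (inj₁ (≤-trans (ι.mono r₂≤q) (∧-elimʳ q≤)))

  name⇒CEU : ∃ (Maximum P._≤_) → ∀ {σ x} → σ ↦ x → x ⊆V̌ᵤ → CEU x
  name⇒CEU (𝟙 , maximal) {σ} {x} σ↦x x⊆V̌ = x⊆V̌ , A , x⃗ ,
      (λ B B≤*A → section-represents B σ↦x (restrict {elements B} {P≤ A} B≤*A x⃗) λ _ → refl) ,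
      λ y p → let (q , q≤p , constant) = section-continuous y p in
        q , q≤p , (𝟙 , P.Eq.refl , maximal q) , λ (r₁ , _) (r₂ , _) r₁≤q r₂≤q →
          mk⇔ (constant r₁ r₂ r₁≤q r₂≤q) (constant r₂ r₁ r₂≤q r₁≤q)
    where
    open ForcedMembers σ

    -- The antichain of the largest element, closed under `≈`: every condition lies below it, so the
    -- representation is uniform on all of P.
    A : MaximalAntichain P
    A = record
      { elements    = P._≈ 𝟙
      ; isAntichain = record
        { respects     = λ p≈q p≈𝟙 → P.Eq.trans (P.Eq.sym p≈q) p≈𝟙
        ; incompatible = λ p≈𝟙 q≈𝟙 p≉q _ → p≉q (P.Eq.trans p≈𝟙 (P.Eq.sym q≈𝟙))
        }
      ; maximal = λ A′ antichain ⊆A′ {p} p∈A′ → by-contradiction λ p≉𝟙 →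
          IsAntichain.incompatible antichain p∈A′ (⊆A′ P.Eq.refl) p≉𝟙 (p , P.refl , maximal p)
      }

    x⃗ : P≤ A →𝕍
    x⃗ = record { to = section ∘ proj₁ ; cong = section-cong }

  -- From a continuous representation to a name.

  module CEUName {x : 𝕍 ℓ} (A : MaximalAntichain P) (x⃗ : P≤ A →𝕍)
                 (represents : RepresentsBelow A x⃗ x) (continuous : Continuous A x⃗) where

    P≤-down : ∀ {p q} → q P.≤ p → P≤ A p → P≤ A q
    P≤-down q≤p (a , a∈A , p≤a) = a , a∈A , P.trans q≤p p≤a

    Always Never : P.Carrier → 𝕍 ℓ → Set ℓ
    Always q y = ∀ (r : ∃ (P≤ A)) → proj₁ r P.≤ q → y ∈ x⃗ ⟨$⟩ r
    Never q y = ∀ (r : ∃ (P≤ A)) → proj₁ r P.≤ q → ¬ (y ∈ x⃗ ⟨$⟩ r)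

    ẋ : Name
    ẋ = name (Σ[ r ∈ ∃ (P≤ A) ] Index (x⃗ ⟨$⟩ r))
      (λ (r , i) → check (component (x⃗ ⟨$⟩ r) i))
      (λ (r , i) → ⋁ {I = Σ[ q ∈ ∃ (P≤ A) ] Always (proj₁ q) (component (x⃗ ⟨$⟩ r) i)} λ (q , _) → ι (proj₁ q))

    always⇒∈ : ∀ {q y v} → P≤ A q → Always q y → v ≤ ι q → v ⊩ check y ∈̇ ẋ
    always⇒∈ {q} {y} q∈ always v≤q =
      let (i , y≐) = ∈-component (x⃗ ⟨$⟩ (q , q∈)) (always (q , q∈) P.refl)
      in ∈-intro ẋ ((q , q∈) , i)
           (⋁-intro _ ((q , q∈) , λ r r≤q → ∈-respˡ (x⃗ ⟨$⟩ r) y≐ (always r r≤q)) v≤q)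
           (check-≐ y _ y≐)

    -- A condition that puts y into `ẋ` is incompatible with q, since at a common extension y would
    -- both be and not be in the set of the representation.
    never⇒∉ : ∀ {q y v c} → Never q y → v ≤ ι q → v ⊩ check y ∈̇ ẋ → v ≤ c
    never⇒∉ {q} {y} {v} {c} never v≤q p = ∈-elim p λ (r , i) w w≤v w≤ y≐ → compare r i w w≤v w≤ y≐
      where
      compare : ∀ r i w → w ≤ v → w ≤ wt ẋ (r , i) → w ⊩ check y ≐̇ elt ẋ (r , i) → w ≤ c
      compare r i w w≤v w≤ y≐ with em {P = y ≐ component (x⃗ ⟨$⟩ r) i}
      ... | no y≐̸  = check-≐̸ y _ y≐̸ y≐
      ... | yes e = ⋁-elim _ w≤ λ (q′ , always) u u≤w u≤q′ →
        incompatible-∧ (λ (s , s≤q′ , s≤q) →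
          let s∈ = s , P≤-down s≤q′ (proj₂ q′) in
          never s∈ s≤q (∈-respˡ (x⃗ ⟨$⟩ s∈) (≐-sym y _ e) (always s∈ s≤q′)))
          u≤q′ (≤-trans u≤w (≤-trans w≤v v≤q))

    -- By continuity, an antichain decides both which set of V the name μ denotes
    -- and whether that set belongs to x⃗.
    module _ (μ : Name) where

      Decides : P.Carrier → Set ℓ
      Decides q = P≤ A q ×
        (∥_∥ {ℓ = ℓ} (∃[ y ] ι q ≤ ⟦ μ ≐ check y ⟧ × (Always q y ⊎ Never q y)) ⊎ ι q ≤ ∁ (V̌-value μ))

      decides-open : ∀ {p q} → q P.≤ p → Decides p → Decides q
      decides-open q≤p (p∈ , inj₁ d) = P≤-down q≤p p∈ , inj₁
        (let (y , p≤ , constant) = unbox d in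
          ∣ y , ≤-trans (ι.mono q≤p) p≤ ,
            [ (λ always → inj₁ λ r r≤q → always r (P.trans r≤q q≤p))
            , (λ never → inj₂ λ r r≤q → never r (P.trans r≤q q≤p)) ]′ constant ∣)
      decides-open q≤p (p∈ , inj₂ p≤) = P≤-down q≤p p∈ , inj₂ (≤-trans (ι.mono q≤p) p≤)

      decides-dense : ∀ p → ∃[ q ] q P.≤ p × Decides q
      decides-dense p = by-contradiction λ none →
        -- Continuity at ∅ serves only to find an extension of p that lies below A.
        let (p′ , p′≤p , p′∈ , _) = continuous ∅ p in
        none (p′ , p′≤p , p′∈ , inj₂ (∁-intro λ w w≤p′ w≤ → V̌-value-elim {μ} w≤ λ y u u≤w μ≐y →
          dense-≤ λ r r≤u →
            let r≤p′ = ι.cancel (≤-trans r≤u (≤-trans u≤w w≤p′))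
                (q , q≤r , q∈ , constant) = continuous y r
            in contradiction (q , P.trans q≤r (P.trans r≤p′ p′≤p) , q∈ ,
                 inj₁ ∣ y , force (weaken (≤-trans (ι.mono q≤r) r≤u) μ≐y) , settled y (q , q∈) constant ∣)
               none))
        where
        settled : ∀ y (q : ∃ (P≤ A)) →
                  (∀ (r₁ r₂ : ∃ (P≤ A)) → proj₁ r₁ P.≤ proj₁ q → proj₁ r₂ P.≤ proj₁ q →
                    (y ∈ x⃗ ⟨$⟩ r₁) ⇔ (y ∈ x⃗ ⟨$⟩ r₂)) →
                  Always (proj₁ q) y ⊎ Never (proj₁ q) y
        settled y q constant with em {P = y ∈ x⃗ ⟨$⟩ q}
        ... | yes y∈ = inj₁ λ r r≤q → to (constant q r P.refl r≤q) y∈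
        ... | no y∉  = inj₂ λ r r≤q y∈ → y∉ (from (constant q r P.refl r≤q) y∈)

      private
        decisive = antichain-in Decides decides-open decides-dense
        B = proj₁ decisive

        B⊆ : ∀ {p} → elements B p → Decides p
        B⊆ = proj₂ decisive

        B≤*A : B ≤* A
        B≤*A b∈B = proj₁ (B⊆ b∈B)

      open OnAntichain B

      private
        ground : ∣A∣ → 𝕍 ℓ
        ground b with proj₂ (B⊆ (proj₂ b))
        ... | inj₁ d = proj₁ (unbox d)
        ... | inj₂ _ = ∅

        decided : ∀ b {w c} → w ≤ V̌-value μ → w ≤ ι̂ b →
                  (w ⊩ μ ≐̇ check (ground b) →
                    Always (proj₁ b) (ground b) ⊎ Never (proj₁ b) (ground b) → w ≤ c) →
                  w ≤ c
        decided b w≤ w≤b f with proj₂ (B⊆ (proj₂ b))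
        ... | inj₁ d  = let (_ , b≤ , constant) = unbox d in f (forced (≤-trans w≤b b≤)) constant
        ... | inj₂ b≤ = ∁-elim (≤-trans w≤b b≤) w≤

        f = fn ground

        x⃗ᴮ : elements B →𝕍
        x⃗ᴮ = restrict {elements B} {P≤ A} B≤*A x⃗

        μ∼f : InV̌ μ → μ ∼ embed f
        μ∼f inV̌ = ⊨-intro (InV̌-elim μ inV̌) λ v≤ → forced (antichain-cases λ b w w≤v w≤b →
          decided (rep b) (≤-trans w≤v v≤) (ι̂-rep b w≤b) λ μ≐ _ →
            force (name-trans μ≐ (name-sym (embed-≐ f b w≤b))))

        -- As μ is in `InV̌`, attention may be restricted to the part of U where b fixes the set
        -- that μ denotes. There b answers "always" or "never", and this one answer governs both
        -- sides.
        f∈x⃗⇔f∈ẋ : InV̌ μ → f Eᴬ x⃗ᴮ ⇔ (⊨ embed f ∈̇ ẋ)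
        f∈x⃗⇔f∈ẋ inV̌ = mk⇔
          (λ fEx⃗ → ⊨-intro (U.meet (InV̌-elim μ inV̌) (agree (to (fn-Eᴬ ground x⃗ᴮ) fEx⃗))) λ v≤ →
            forced (antichain-cases λ b w w≤v w≤b →
              decided (rep b) (≤-trans w≤v (∧-elimˡ v≤)) (ι̂-rep b w≤b) λ _ →
                [ (λ always → force (∈-replaceˡ (name-sym (embed-≐ f b w≤b))
                    (always⇒∈ (B≤*A (proj₂ (rep b))) always (ι̂-rep b w≤b))))
                , (λ never → truth-elim
                    (glue-elim (λ b → truth (ground b ∈ x⃗ᴮ ⟨$⟩ b)) b w≤b (≤-trans w≤v (∧-elimʳ v≤)))
                    λ g∈ → contradiction g∈ (never (proj₁ (rep b) , B≤*A (proj₂ (rep b))) P.refl)) ]′))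
          (λ f∈ẋ → from (fn-Eᴬ ground x⃗ᴮ) (almost (U.upward
            (glue-intro (λ b → truth (ground b ∈ x⃗ᴮ ⟨$⟩ b)) λ b w w≤ w≤b →
              decided (rep b) (∧-elimˡ w≤) (ι̂-rep b w≤b) λ _ →
                [ (λ always → truth-intro (always (proj₁ (rep b) , B≤*A (proj₂ (rep b))) P.refl))
                , (λ never → never⇒∉ never (ι̂-rep b w≤b)
                    (∈-replaceˡ (embed-≐ f b w≤b) (forced {φ = embed f ∈̇ ẋ} (∧-elimʳ w≤)))) ]′)
            (U.meet (InV̌-elim μ inV̌) (holds f∈ẋ)))))

      -- The antichain B depends on μ; uniformity below A is what allows x to be evaluated along it.
      ∈⇔∈ẋ : ∀ {z} → InV̌ μ → μ ↦ z → z ∈ x ⇔ (⊨ μ ∈̇ ẋ)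
      ∈⇔∈ẋ inV̌ μ↦z = mk⇔
        (λ z∈x → ⊨∈-respˡ (∼-sym (μ∼f inV̌)) (to (f∈x⃗⇔f∈ẋ inV̌) (from rep-x z∈x)))
        (λ μ∈ẋ → to rep-x (from (f∈x⃗⇔f∈ẋ inV̌) (⊨∈-respˡ (μ∼f inV̌) μ∈ẋ)))
        where
        rep-x = represents-elim B Ġ↦G x⃗ᴮ x (represents B B≤*A) f (↦-resp (μ∼f inV̌) μ↦z)

  CEU⇒name : ∀ {x} → CEU x → ∃[ ẋ ] (∀ {μ z} → InV̌ μ → μ ↦ z → z ∈ x ⇔ (⊨ μ ∈̇ ẋ))
  CEU⇒name (_ , A , x⃗ , represents , continuous) = ẋ , λ {μ} → ∈⇔∈ẋ μ
    where open CEUName A x⃗ represents continuous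

  -- Coding a set of named elements by a subset of the Boolean ultrapower.

  -- x = { g i ∣ i ∈ I } with g i the value of σ i.  As x need not be a subset of
  -- V̌ᵤ, it is coded by the subset x′ of j(x) along the name Φ of g i ↦ σ i.
  module Code {I : Set ℓ} (g : I → 𝕍 ℓ) (σ : I → Name) (σ↦g : ∀ i → σ i ↦ g i)
              (σ-cong : ∀ {i i′} → g i ≐ g i′ → σ i ≡ σ i′) where

    private
      x : 𝕍 ℓ
      x = sup I g

    Φ : Name
    Φ = name I (λ i → pair (check (g i)) (σ i)) (λ _ → 𝟏)

    Φ-intro : ∀ i {μ ν v} → v ⊩ μ ≐̇ check (g i) → v ⊩ ν ≐̇ σ i → v ⊩ pair μ ν ∈̇ Φ
    Φ-intro i p q = ∈-intro Φ i (maximum _) (pair-cong p q)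

    Φ-elim : ∀ {μ ν v c} → v ⊩ pair μ ν ∈̇ Φ →
             (∀ i w → w ≤ v → w ⊩ μ ≐̇ check (g i) → w ⊩ ν ≐̇ σ i → w ≤ c) → v ≤ c
    Φ-elim {μ} {ν} p f = ∈-elim p λ i w w≤v _ q → f i w w≤v
      (pair-injˡ {μ} {ν} {check (g i)} {σ i} q) (pair-injʳ {μ} {ν} {check (g i)} {σ i} q)

    -- Equal elements of x must share one name, as `σ-cong` ensures: two names of the same value
    -- agree only modulo U, whereas functionality is claimed below every v.
    Φ-functional : ∀ {μ ν ν′ v} → v ⊩ pair μ ν ∈̇ Φ → v ⊩ pair μ ν′ ∈̇ Φ → v ⊩ ν ≐̇ ν′
    Φ-functional {ν = ν} {ν′} p q = forced (Φ-elim p λ i w w≤v μ≐i ν≐i →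
      Φ-elim (weaken w≤v q) λ i′ u u≤w μ≐i′ ν′≐i′ →
        compare i i′ u (name-trans (name-sym (weaken u≤w μ≐i)) μ≐i′) (weaken u≤w ν≐i) ν′≐i′)
      where
      compare : ∀ i i′ u → u ⊩ check (g i) ≐̇ check (g i′) → u ⊩ ν ≐̇ σ i → u ⊩ ν′ ≐̇ σ i′ → u ≤ ⟦ ν ≐ ν′ ⟧
      compare i i′ u e ν≐ ν′≐ with em {P = g i ≐ g i′}
      ... | no gi≐̸ = check-≐̸ (g i) (g i′) gi≐̸ e
      ... | yes gi≐ with σ i | σ-cong gi≐
      ... | _ | refl = force (name-trans ν≐ (name-sym ν′≐))

    Φ-domain : ∀ {μ ν v} → v ⊩ pair μ ν ∈̇ Φ → v ⊩ μ ∈̇ check x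
    Φ-domain p = forced (Φ-elim p λ i w _ μ≐ _ → force (∈-intro (check x) i (maximum w) μ≐))

    range : Name
    range = name I σ (λ _ → 𝟏)

    Φ-range : ∀ {μ ν v} → v ⊩ pair μ ν ∈̇ Φ → v ⊩ ν ∈̇ range
    Φ-range p = forced (Φ-elim p λ i w _ _ ν≐ → force (∈-intro range i (maximum w) ν≐))

    Φ-cong : ∀ {μ ν μ′ ν′} → μ ∼ μ′ → ν ∼ ν′ → ⊨ pair μ ν ∈̇ Φ → ⊨ pair μ′ ν′ ∈̇ Φ
    Φ-cong μ∼μ′ ν∼ν′ = ⊨∈-respˡ (⊨-zip pair-cong μ∼μ′ ν∼ν′)

    Φ-InV̌ : ∀ {μ ν} → ⊨ pair μ ν ∈̇ Φ → InV̌ μ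
    Φ-InV̌ p = InV̌-∈ (InV̌-check x) (⊨-map Φ-domain p)

    -- The point z lies in j(x) and the value of Φ sends it to an element of x; thus `x′` is the
    -- preimage of x under that function.
    Coded : 𝕍 ℓ → Name → Name → Set (suc ℓ)
    Coded z μ ν = (⊨ pair μ ν ∈̇ Φ) × μ ↦ z × (∃[ i ] ν ↦ g i)

    -- Weights that name an argument and a value of Φ by `select`. They form a set, so `x′` has a
    -- small index.
    Keys : Set ℓ
    Keys = (I → 𝔹) × (I → 𝔹)

    first second : Keys → Name
    first (u , _)  = select (check x) u
    second (_ , u) = select range u

    x′ : 𝕍 ℓ
    x′ = sup (Σ[ k ∈ Keys ] ∥_∥ {ℓ = ℓ} (∃[ z ] Coded z (first k) (second k))) λ (_ , p) → proj₁ (unbox p)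

    ∈x′-intro : ∀ {z μ ν} → Coded z μ ν → z ∈ x′
    ∈x′-intro {z} {μ} {ν} (μν∈Φ , μ↦z , i , ν↦gi) = (k , p) ,
      ↦-unique (↦-resp (∼-sym first∼μ) μ↦z) (proj₁ (proj₂ (proj₂ (unbox p))))
      where
      k : Keys
      k = member-weights μ (check x) , member-weights ν range
      first∼μ : first k ∼ μ
      first∼μ = ⊨-map select-≐ (⊨-map Φ-domain μν∈Φ)
      second∼ν : second k ∼ ν
      second∼ν = ⊨-map select-≐ (⊨-map Φ-range μν∈Φ)
      p : ∥_∥ {ℓ = ℓ} (∃[ z ] Coded z (first k) (second k))
      p = ∣ z , Φ-cong (∼-sym first∼μ) (∼-sym second∼ν) μν∈Φ ,
              ↦-resp (∼-sym first∼μ) μ↦z , i , ↦-resp (∼-sym second∼ν) ν↦gi ∣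

    ∈x′-elim : ∀ {z} → z ∈ x′ → ∃[ k ] Coded z (first k) (second k)
    ∈x′-elim {z} ((k , p) , z≐) = k , let (_ , μν∈Φ , μ↦ , ν↦) = unbox p in
      μν∈Φ , ↦-≐ (≐-sym z _ z≐) μ↦ , ν↦

    x′⊆V̌ : x′ ⊆V̌ᵤ
    x′⊆V̌ z z∈x′ = let (k , μν∈Φ , μ↦z , _) = ∈x′-elim z∈x′ in first k , Φ-InV̌ μν∈Φ , collapse μ↦z

    module _ (A : MaximalAntichain P) where
      open OnAntichain A

      private
        pair-mixᴬ : ∀ f h a {v} → v ≤ ι̂ a → v ⊩ pair (mixᴬ f) (mixᴬ h) ≐̇ pair (f (rep a)) (h (rep a))
        pair-mixᴬ f h a v≤a = pair-cong (mixᴬ-≐ f a v≤a) (mixᴬ-≐ h a v≤a)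

      Φ-glue : ∀ f h → (⊨ pair (mixᴬ f) (mixᴬ h) ∈̇ Φ) ⇔ U-glue (λ a → ⟦ pair (f a) (h a) ∈ Φ ⟧)
      Φ-glue f h = mk⇔
        (λ p → glued (U.upward (glue-intro (λ a → ⟦ pair (f a) (h a) ∈ Φ ⟧) λ a w w≤ w≤a → force
          (∈-replaceˡ (pair-mixᴬ f h a w≤a) (forced {φ = pair (mixᴬ f) (mixᴬ h) ∈̇ Φ} w≤))) (holds p)))
        (λ p → ⊨-intro (unglue p) λ v≤ → forced (antichain-cases λ a w w≤v w≤a → force
          (∈-replaceˡ (name-sym (pair-mixᴬ f h a w≤a)) (forced {φ = pair (f (rep a)) (h (rep a)) ∈̇ Φ}
            (glue-elim (λ a → ⟦ pair (f a) (h a) ∈ Φ ⟧) a w≤a (≤-trans w≤v v≤))))))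

      module _ {k : elements A →𝕍} (k↦x : k ↦ᴬ x) where

        -- `Coded` as computed in the fibre at a: `G⃗ a` stands for U, the collapse of `Local A a`
        -- for that of E, and `k ⟨$⟩ a` for x.
        LocallyCoded : ∣A∣ → 𝕍 ℓ → Keys → 𝕍 ℓ → Set (suc ℓ)
        LocallyCoded a v κ w = ⌜ ⟦ pair (first κ) (second κ) ∈ Φ ⟧ ⌝ ∈ G⃗ ⟨$⟩ proj₁ a ×
          Collapse (Local A a) (first κ) v × w ∈ k ⟨$⟩ a × Collapse (Local A a) (second κ) w

        F : ∣A∣ → 𝕍 ℓ
        F a = sup (Σ[ κ ∈ Keys ] ∥_∥ {ℓ = ℓ} (∃[ v ] ∃[ w ] LocallyCoded a v κ w)) λ (_ , p) → proj₁ (unbox p)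

        ∈F-intro : ∀ a {v κ w} → LocallyCoded a v κ w → v ∈ F a
        ∈F-intro a {v} {κ} {w} c@(_ , col , _) = (κ , p) ,
          collapse-unique (Local A a) v _ col (proj₁ (proj₂ (proj₂ (proj₂ (unbox p)))))
          where
          p : ∥_∥ {ℓ = ℓ} (∃[ v ] ∃[ w ] LocallyCoded a v κ w)
          p = ∣ v , w , c ∣

        ∈F-elim : ∀ a {v} → v ∈ F a → ∃[ (κ , w) ] LocallyCoded a v κ w
        ∈F-elim a {v} ((κ , p) , v≐) = let (v′ , w , φ∈ , col , rest) = unbox p in
          (κ , w) , φ∈ , collapse-≐ (Local A a) v′ v (≐-sym v v′ v≐) col , rest

        -- For a predecessor of F, the keys chosen in the fibres are mixed into one pair of names in
        -- Φ. For a member of `x′`, one pair of keys is used at all a, and its fibrewise collapses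
        -- give the predecessor.
        F↦x′ : fn F ↦ᴬ x′
        F↦x′ = collapsesᴬ (collapse-intro _Eᴬ_ {fn F} x′
          (λ d dEF → let (z , z∈x′ , d↦z) = predecessor d dEF in z , z∈x′ , collapseᴬ d↦z)
          (λ z z∈x′ → let (d , dEF , d↦z) = member (∈x′-elim z∈x′) in d , dEF , collapseᴬ d↦z))
          where
          predecessor : ∀ d → d Eᴬ fn F → ∃[ z ] z ∈ x′ × d ↦ᴬ z
          predecessor d dEF = keys
              (Uae-choice {Y = Keys × 𝕍 ℓ} {φ = λ a (κ , w) → LocallyCoded a (d ⟨$⟩ a) κ w}
                (((λ _ → 𝟎) , (λ _ → 𝟎)) , ∅) (Uae-map (λ a → ∈F-elim a) (to (Eᴬ-fn d F) dEF)))
            where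
            keys : (∃[ s ] Uae (λ a → LocallyCoded a (d ⟨$⟩ a) (proj₁ (s a)) (proj₂ (s a)))) →
                   ∃[ z ] z ∈ x′ × d ↦ᴬ z
            keys (s , p) = value-of (V̌-collapse (mixᴬ μ) (Φ-InV̌ μν∈Φ)) element
              where
              μ = first ∘ proj₁ ∘ s
              ν = second ∘ proj₁ ∘ s
              w = proj₂ ∘ s
              μν∈Φ : ⊨ pair (mixᴬ μ) (mixᴬ ν) ∈̇ Φ
              μν∈Φ = from (Φ-glue μ ν) (from (glue⇔G⃗ A λ a → ⟦ pair (μ a) (ν a) ∈ Φ ⟧)
                (Uae-map (λ _ → proj₁) p))
              element : ∃[ i ] fn w ↦ᴬ g i
              element = let (i , w↦) = proj₁ (collapseᴬ k↦x) (fn w)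
                              (from (fn-Eᴬ w k) (Uae-map (λ _ c → proj₁ (proj₂ (proj₂ c))) p))
                        in i , collapsesᴬ w↦
              value-of : ∃ (mixᴬ μ ↦_) → ∃[ i ] fn w ↦ᴬ g i → ∃[ z ] z ∈ x′ × d ↦ᴬ z
              value-of (z , μ↦z) (i , w↦gi) = z ,
                ∈x′-intro (μν∈Φ , μ↦z , i ,
                  local⇒↦ A (g i) ν (Uae-map (λ _ c → proj₂ (proj₂ (proj₂ c))) p) w↦gi) ,
                ↦ᴬ-resp (≋-sym (fn-⟨$⟩ d)) (↦⇒local A z μ (Uae-map (λ _ c → proj₁ (proj₂ c)) p) μ↦z)

          member : ∀ {z} → ∃[ κ ] Coded z (first κ) (second κ) → ∃[ d ] d Eᴬ fn F × d ↦ᴬ z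
          member {z} (κ , μν∈Φ , μ↦z , i , ν↦gi) = locally
              (local-collapse A (λ _ → first κ) (↦-resp (∼-sym first∼) μ↦z))
              (local-collapse A (λ _ → second κ) (↦-resp (∼-sym second∼) ν↦gi))
            where
            first∼ : mixᴬ (λ _ → first κ) ∼ first κ
            first∼ = ∼-intro (mixᴬ-const (first κ))
            second∼ : mixᴬ (λ _ → second κ) ∼ second κ
            second∼ = ∼-intro (mixᴬ-const (second κ))
            Φ∈G⃗ : Uae (λ a → ⌜ ⟦ pair (first κ) (second κ) ∈ Φ ⟧ ⌝ ∈ G⃗ ⟨$⟩ proj₁ a)
            Φ∈G⃗ = to (glue⇔G⃗ A λ _ → ⟦ pair (first κ) (second κ) ∈ Φ ⟧)
              (to (Φ-glue (λ _ → first κ) (λ _ → second κ)) (Φ-cong (∼-sym first∼) (∼-sym second∼) μν∈Φ))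
            locally : (∃[ v ] Uae (λ a → Collapse (Local A a) (first κ) (v a)) × fn v ↦ᴬ z) →
                      (∃[ w ] Uae (λ a → Collapse (Local A a) (second κ) (w a)) × fn w ↦ᴬ g i) →
                      ∃[ d ] d Eᴬ fn F × d ↦ᴬ z
            locally (v , col-v , v↦z) (w , col-w , w↦gi) = fn v , from (fn-Eᴬ-fn v F) coded , v↦z
              where
              w∈k : Uae (λ a → w a ∈ k ⟨$⟩ a)
              w∈k = to (fn-Eᴬ w k) (↦ᴬ-∈⁻¹ k↦x w↦gi (i , ≐-refl (g i)))
              coded : Uae (λ a → v a ∈ F a)
              coded = Uae-zip (λ a (φ∈ , cv) (w∈ , cw) → ∈F-intro a {v a} {κ} {w a} (φ∈ , cv , w∈ , cw))
                (Uae-zip (λ _ → _,_) Φ∈G⃗ col-v) (Uae-zip (λ _ → _,_) w∈k col-w)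

    x′∈⋂M : ⋂M x → ⋂M x′
    x′∈⋂M x∈⋂M A = coded (x∈⋂M A)
      where
      open OnAntichain A
      coded : M A x → M A x′
      coded (k , [k]) = fn (F A {k} k↦x) , collapseᴬ (F↦x′ A {k} k↦x)
        where
        k↦x : k ↦ᴬ x
        k↦x = collapsesᴬ [k]

    -- τ names the image of `ẋ` under Φ. A member d of τ may come from a mixture μ of the arguments,
    -- so from a point of j(x) other than the j(g i). Still the value of μ is in `x′`, so Φ sends it
    -- into x, and functionality identifies d with that image.
    decode : ∀ ẋ → (∀ {μ z} → InV̌ μ → μ ↦ z → z ∈ x′ ⇔ (⊨ μ ∈̇ ẋ)) → ∃[ τ ] τ ↦ x
    decode ẋ ∈x′⇔∈ẋ = τ , collapses (into , λ i → σ i , holds (σ∈τ i) , collapse (σ↦g i))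
      where
      τ : Name
      τ = name I σ λ i → ⟦ check (g i) ∈ ẋ ⟧

      σ∈τ : ∀ i → ⊨ σ i ∈̇ τ
      σ∈τ i = go (V̌-collapse (check (g i)) (InV̌-check (g i)))
        where
        go : ∃ (check (g i) ↦_) → ⊨ σ i ∈̇ τ
        go (z , gi↦z) = ⊨-intro
          (holds (to (∈x′⇔∈ẋ (InV̌-check (g i)) gi↦z) (∈x′-intro
            (⊨-intro U.top (λ _ → Φ-intro i (name-refl _) (name-refl _)) , gi↦z , i , σ↦g i))))
          λ v≤ → ∈-intro τ i v≤ (name-refl (σ i))

      into : ∀ d → d E τ → ∃[ i ] Collapse _E_ d (g i)
      into d dEτ = go (fullness (λ i → ⟦ check (g i) ∈ ẋ ⟧ ∧ ⟦ d ≐ σ i ⟧) (check ∘ g))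
        where
        go : ∃[ μ ] (∀ {v} → v ≤ ⟦ d ∈ τ ⟧ →
               v ≤ ⋁ λ i → (⟦ check (g i) ∈ ẋ ⟧ ∧ ⟦ d ≐ σ i ⟧) ∧ ⟦ μ ≐ check (g i) ⟧) →
             ∃[ i ] Collapse _E_ d (g i)
        go (μ , realised) = value-of (V̌-collapse μ (Φ-InV̌ μd∈Φ))
          where
          choice = U.upward (realised ≤-refl) dEτ
          μ∈ẋ : ⊨ μ ∈̇ ẋ
          μ∈ẋ = ⊨-intro choice λ v≤ → forced (⋁-elim _ v≤ λ i w _ w≤ → force (∈-replaceˡ
            (name-sym (forced {φ = μ ≐̇ check (g i)} (∧-elimʳ w≤)))
            (forced {φ = check (g i) ∈̇ ẋ} (∧-elimˡ (∧-elimˡ w≤)))))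
          μd∈Φ : ⊨ pair μ d ∈̇ Φ
          μd∈Φ = ⊨-intro choice λ v≤ → forced (⋁-elim _ v≤ λ i w _ w≤ → force (Φ-intro i
            (forced {φ = μ ≐̇ check (g i)} (∧-elimʳ w≤))
            (forced {φ = d ≐̇ σ i} (∧-elimʳ (∧-elimˡ w≤)))))
          value-of : ∃ (μ ↦_) → ∃[ i ] Collapse _E_ d (g i)
          value-of (z , μ↦z) =
            let (k , kk∈Φ , k↦z , i , ν↦gi) = ∈x′-elim (from (∈x′⇔∈ẋ (Φ-InV̌ μd∈Φ) μ↦z) μ∈ẋ)
                μν∈Φ = Φ-cong (↦-injective k↦z μ↦z) (∼-intro (name-refl (second k))) kk∈Φ
            in i , collapse (↦-resp (⊨-zip Φ-functional μν∈Φ μd∈Φ) ν↦gi)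

  -- Induction over the intersection of the ultrapowers, and the equivalence.

  ⋂M-transitive : ∀ {I : Set ℓ} {g : I → 𝕍 ℓ} → ⋂M (sup I g) → ∀ i → ⋂M (g i)
  ⋂M-transitive x∈⋂M i A = let (_ , _ , onto) = x∈⋂M A ; (d , _ , d↦) = onto i in d , d↦

  ⋂M⊆V^𝔹/U : (∀ x → ⋂M x → x ⊆V̌ᵤ → CEU x) → ∀ x → ⋂M x → ∃[ σ ] σ ↦ x
  ⋂M⊆V^𝔹/U CEU-all (sup I g) x∈⋂M =
    let (ẋ , ∈x′⇔∈ẋ) = CEU⇒name (CEU-all x′ (x′∈⋂M x∈⋂M) x′⊆V̌) in decode ẋ ∈x′⇔∈ẋ
    where
    named : ∀ i → ∃[ σ ] σ ↦ g i
    named i = ⋂M⊆V^𝔹/U CEU-all (g i) (⋂M-transitive x∈⋂M i)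

    -- The induction yields a name for each index; taking the one at a representative index makes it
    -- depend only on the element, as `σ-cong` demands.
    SameElement : Setoid ℓ ℓ
    SameElement = On.setoid 𝕍-setoid g

    open Code g (proj₁ ∘ named ∘ canonical ac SameElement)
      (λ i → ↦-≐ (canonical-≈ ac SameElement i) (proj₂ (named (canonical ac SameElement i))))
      (λ gi≐ → cong (proj₁ ∘ named) (canonical-≡ ac SameElement gi≐))

theorem4p8 : (∀ {a} → ExcludedMiddle a) →
    ∀ {ℓ} → AxiomOfChoice ℓ →
    (P : Poset ℓ ℓ ℓ) → Separative P → ∃ (Maximum (Poset._≤_ P)) →
    (𝔹 : Completion P) (U : Ultrafilter (Completion.algebra 𝔹)) →
    let open BooleanUltrapower P 𝔹 U in
    WellFounded _Eᵛ_ →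
    (G : 𝕍 ℓ) → [ Ġ ]≐ G → UniformlyRepresented G →
    (∀ x → ⋂M x ⇔ V^𝔹/U x) ⇔ (∀ x → ⋂M x → x ⊆V̌ᵤ → CEU x)
theorem4p8 em {ℓ} ac P _ max C U wf G [Ġ] (_ , G⃗ , representsG) = mk⇔
  (λ ⋂M⇔V^𝔹/U x x∈⋂M → name-CEU (Equivalence.to (⋂M⇔V^𝔹/U x) x∈⋂M))
  (λ CEU-all x → mk⇔ (λ x∈⋂M → named (⋂M⊆V^𝔹/U CEU-all x x∈⋂M)) in-every-M)
  where
  open BooleanUltrapower P C U
  open Ultrapowers em ac P C U
  open UniformGeneric em ac P C U wf G [Ġ] G⃗ representsG

  name-CEU : ∀ {x} → V^𝔹/U x → x ⊆V̌ᵤ → CEU x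
  name-CEU (σ , [σ]) = name⇒CEU max (collapses [σ])

  named : ∀ {x} → ∃[ σ ] σ ↦ x → V^𝔹/U x
  named (σ , σ↦x) = σ , collapse σ↦x

  in-every-M : ∀ {x} → V^𝔹/U x → ⋂M x
  in-every-M (σ , [σ]) A = V^𝔹/U⊆M A (collapses [σ])
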